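{- Let $F_1(n)$ denote the number of partitions of $n$ into parts $\equiv\pm1,\pm19,\pm36$ or $\pm38\pmod{76}$ such that the parts $\equiv\pm1$ and $\pm19\pmod{76}$ have $2$ colors. Let $F_2(n)$ denote the number of partitions of $n$ into parts $\equiv\pm19,\pm36,\pm37$ or $\pm38\pmod{76}$ such that the parts $\equiv\pm19$ and $\pm37\pmod{76}$ have $2$ colors. Let $F_3(n)$ denote the number of partitions of $n$ into parts $\equiv\pm1,\pm18,\pm20$ and $\pm37\pmod{76}$ such that the parts $\equiv\pm1$ and $\pm37\pmod{76}$ have $2$ colors. Here $+38$ and $-38$ are counted as two separate residues (although they coincide modulo $76$), so that parts $\equiv38\pmod{76}$ occur in $2$ colors in total in $F_1$ and in $F_2$. Then for every integer $n\ge18$, $$F_1(n)+F_2(n-18)=F_3(n).$$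
   Context: A part in a partition has $r$ colors if there are $r$ copies of each such part, all viewed as distinct objects; parts for which no number of colors is specified have one color. Partitions are unordered, and each of the counting functions equals $1$ at $n=0$. With $(\lambda;q)_\infty=\prod_{j\ge0}(1-\lambda q^j)$, $(\lambda_1,\dots,\lambda_s;q)_\infty=\prod_{j}(\lambda_j;q)_\infty$ and the convention $(q^{r\pm};q^t)_\infty:=(q^r,q^{t-r};q^t)_\infty$ for $0<r<t$ (so $(q^{38\pm};q^{76})_\infty=(q^{38};q^{76})_\infty^2$), and $(q^{r_1\pm},\dots,q^{r_s\pm};q^t)_\infty:=\prod_j (q^{r_j\pm};q^t)_\infty$, the generating functions are $$\sum_{n\ge0}F_1(n)q^n=\frac{1}{(q^{36\pm},q^{38\pm};q^{76})_\infty(q^{1\pm},q^{19\pm};q^{76})_\infty^2},$$ $$\sum_{n\ge0}F_2(n)q^n=\frac{1}{(q^{36\pm},q^{38\pm};q^{76})_\infty(q^{19\pm},q^{37\pm};q^{76})_\infty^2},$$ $$\sum_{n\ge0}F_3(n)q^n=\frac{1}{(q^{18\pm},q^{20\pm};q^{76})_\infty(q^{1\pm},q^{37\pm};q^{76})_\infty^2}.$$ -}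

module Defs where

open import Data.Bool using (if_then_else_)
open import Data.Empty using (⊥-elim)
open import Data.Fin using (Fin; zero; suc)
import Data.Fin.Properties as Fin
open import Data.List using (List; []; _∷_; _++_; map; concatMap; filter; length; lookup; replicate; upTo; allFin)
open import Data.List.Membership.Propositional using (_∈_; find; lose)
open import Data.List.Membership.Propositional.Properties using (∈-map⁺; ∈-map⁻; ∈-concatMap⁺; ∈-concatMap⁻; ∈-filter⁺; ∈-filter⁻; ∈-upTo⁺; ∈-lookup; ∈-allFin)
open import Data.List.Properties using (filter-all; filter-none; filter-++; length-replicate; ++-identityʳ; map-++)
open import Data.List.Relation.Binary.Permutation.Propositional using (_↭_; ↭-refl; ↭-sym; ↭-trans; ↭-setoid; prep)
open import Data.List.Relation.Binary.Permutation.Propositional.Properties using (↭-length; filter-↭; drop-∷; ++⁺ˡ; shift) renaming (map⁺ to ↭-map⁺)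
open import Data.List.Relation.Unary.All as All using (All; []; _∷_)
import Data.List.Relation.Unary.All.Properties as All
open import Data.List.Relation.Unary.AllPairs as AllPairs using (AllPairs; []; _∷_)
import Data.List.Relation.Unary.AllPairs.Properties as AllPairs
open import Data.List.Relation.Unary.Any as Any using (Any; here; there; index)
open import Data.List.Relation.Unary.Any.Properties using (lookup-index)
open import Data.List.Relation.Unary.Unique.Propositional using (Unique)
import Data.List.Relation.Unary.Unique.Propositional.Properties as Unique
import Data.List.Relation.Unary.Unique.Setoid as SetoidUnique
import Data.List.Relation.Unary.Unique.Setoid.Properties as SetoidUnique
open import Data.Nat using (ℕ; zero; suc; _+_; _*_; _∸_; _≤_; _≤?_; ∣_-_∣; s≤s; NonZero)
open import Data.Nat.Divisibility using (_∣?_)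
open import Data.Nat.ListAction using (sum)
open import Data.Nat.ListAction.Properties using (sum-++; sum-↭)
import Data.Nat.Properties as ℕ
open import Data.Product using (Σ-syntax; ∃-syntax; _×_; _,_; proj₁; proj₂)
open import Function using (_∘_; Inverse)
open import Relation.Binary.Bundles using (Setoid)
open import Relation.Binary.Definitions using (DecidableEquality)
import Relation.Binary.Construct.On as On
open import Relation.Binary.PropositionalEquality as ≡ using (_≡_; _≢_; refl; cong; subst)
open import Relation.Nullary using (¬_; yes; no; ⌊_⌋)

-- Throughout, c k is the number of colours in which the part k is available
-- (no part k is allowed when c k = 0).
record Part (c : ℕ → ℕ) : Set where
  constructor part
  field
    size          : ℕ
    .{{positive}} : NonZero size
    colour        : Fin (c size)

open Part using (size)

weight : ∀ {c} → List (Part c) → ℕ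
weight xs = sum (map size xs)

-- Partitions of n are unordered: lists of coloured parts with sum n, up to
-- permutation.
Partition : (ℕ → ℕ) → ℕ → Setoid _ _
Partition c n = On.setoid {B = Σ[ xs ∈ List (Part c) ] weight xs ≡ n} (↭-setoid {A = Part c}) proj₁

-- The number of signs ± for which k ≡ ± r (mod t).  The two signs count
-- separately, so the value is 2 when r ≡ - r (mod t) and k ≡ r (mod t).
signs : ℕ → ℕ → ℕ → ℕ
signs t r k = (if ⌊ t ∣? ∣ k - r ∣ ⌋ then 1 else 0) + (if ⌊ t ∣? (k + r) ⌋ then 1 else 0)

-- Each entry (r , m) provides m colours for the parts ≡ r and m colours for
-- the parts ≡ - r (mod t).
colours : ℕ → List (ℕ × ℕ) → ℕ → ℕ
colours t rs k = sum (map (λ (r , m) → m * signs t r k) rs)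

-- Partitions of n with parts from ps: the first part p of ps gets
-- multiplicity m, where m * size p ≤ n, and the rest is chosen recursively.
enumerate : ∀ {c} → List (Part c) → ℕ → List (List (Part c))
enumerate []       zero    = [] ∷ []
enumerate []       (suc _) = []
enumerate (p ∷ ps) n       =
  concatMap (λ m → map (replicate m p ++_) (enumerate ps (n ∸ m * size p)))
            (filter (λ m → m * size p ≤? n) (upTo (suc n)))

partsUpTo : ∀ c → ℕ → List (Part c)
partsUpTo c n = concatMap (λ k → map (part (suc k)) (allFin (c (suc k)))) (upTo n)

-- A complete list, without repetition, of representatives of the elements of
-- Partition c n; see countPartitions-correct.
partitions : ∀ c → ℕ → List (List (Part c))
partitions c n = enumerate (partsUpTo c n) n

countPartitions : (ℕ → ℕ) → ℕ → ℕ
countPartitions c n = length (partitions c n)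

F₁ F₂ F₃ : ℕ → ℕ
F₁ = countPartitions (colours 76 ((1 , 2) ∷ (19 , 2) ∷ (36 , 1) ∷ (38 , 1) ∷ []))
F₂ = countPartitions (colours 76 ((19 , 2) ∷ (36 , 1) ∷ (37 , 2) ∷ (38 , 1) ∷ []))
F₃ = countPartitions (colours 76 ((1 , 2) ∷ (18 , 1) ∷ (20 , 1) ∷ (37 , 2) ∷ []))

-- The rest of the module proves that countPartitions c n is the cardinality
-- of Partition c n.

private
  module _ {a ℓ} (S : Setoid a ℓ) where
    open Setoid S using (_≈_; sym)

    lookup-injective : ∀ {xs} → SetoidUnique.Unique S xs → ∀ i j →
                       lookup xs i ≈ lookup xs j → i ≡ j
    lookup-injective (_  ∷ _)  zero    zero    _ = refl
    lookup-injective (x∉ ∷ _)  zero    (suc j) e = ⊥-elim (All.lookup x∉ (∈-lookup j) e)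
    lookup-injective (x∉ ∷ _)  (suc i) zero    e = ⊥-elim (All.lookup x∉ (∈-lookup i) (sym e))
    lookup-injective (_  ∷ !)  (suc i) (suc j) e = cong suc (lookup-injective ! i j e)

  module _ {c : ℕ → ℕ} where

    _≟_ : DecidableEquality (Part c)
    part k i ≟ part l j with k ℕ.≟ l
    ... | no  k≢l  = no (k≢l ∘ cong size)
    ... | yes refl with i Fin.≟ j
    ...   | no  i≢j  = no λ { refl → i≢j refl }
    ...   | yes refl = yes refl

    Lists : Setoid _ _
    Lists = ↭-setoid {A = Part c}

    weight-++ : ∀ (xs ys : List (Part c)) → weight (xs ++ ys) ≡ weight xs + weight ys
    weight-++ xs ys = ≡.trans (cong sum (map-++ size xs ys)) (sum-++ (map size xs) (map size ys))

    weight-replicate : ∀ m (p : Part c) → weight (replicate m p) ≡ m * size p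
    weight-replicate zero    p = refl
    weight-replicate (suc m) p = cong (size p +_) (weight-replicate m p)

    weight-replicate-++ : ∀ m (p : Part c) ys → weight (replicate m p ++ ys) ≡ m * size p + weight ys
    weight-replicate-++ m p ys =
      ≡.trans (weight-++ (replicate m p) ys) (cong (_+ weight ys) (weight-replicate m p))

    weight-↭ : {xs ys : List (Part c)} → xs ↭ ys → weight xs ≡ weight ys
    weight-↭ = sum-↭ ∘ ↭-map⁺ size

    block : Part c → List (Part c) → ℕ → ℕ → List (List (Part c))
    block p ps n m = map (replicate m p ++_) (enumerate ps (n ∸ m * size p))

    sound : ∀ (ps : List (Part c)) {n xs} → xs ∈ enumerate ps n → All (_∈ ps) xs × weight xs ≡ n
    sound []       {zero} (here refl) = [] , refl
    sound (p ∷ ps) {n} xs∈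
      with m , m∈ , xs∈block ← find (∈-concatMap⁻ (block p ps n) xs∈)
      with ys , ys∈ , refl ← ∈-map⁻ (replicate m p ++_) xs∈block
      with ys⊆ , wys ← sound ps ys∈
      = All.++⁺ (All.replicate⁺ m (here refl)) (All.map there ys⊆)
      , ≡.trans (weight-replicate-++ m p ys)
          (≡.trans (cong (m * size p +_) wys)
            (ℕ.m+[n∸m]≡n (proj₂ (∈-filter⁻ (λ m → m * size p ≤? n) {xs = upTo (suc n)} m∈))))

    split : ∀ (p : Part c) xs → ∃[ m ] ∃[ ys ] xs ↭ replicate m p ++ ys × All (λ y → p ≢ y × y ∈ xs) ys
    split p [] = 0 , [] , ↭-refl , []
    split p (x ∷ xs) with m , ys , xs↭ , ys⊆ ← split p xs | p ≟ x
    ... | yes refl = suc m , ys , prep p xs↭ , All.map (λ (p≢y , y∈) → p≢y , there y∈) ys⊆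
    ... | no  p≢x  = m , x ∷ ys
      , ↭-trans (prep x xs↭) (↭-sym (shift x (replicate m p) ys))
      , (p≢x , here refl) ∷ All.map (λ (p≢y , y∈) → p≢y , there y∈) ys⊆

    complete : ∀ (ps : List (Part c)) {n xs} → All (_∈ ps) xs → weight xs ≡ n → Any (xs ↭_) (enumerate ps n)
    complete []       {xs = []}    _        refl = here ↭-refl
    complete []       {xs = _ ∷ _} (() ∷ _) _
    complete (p ∷ ps) {n} {xs} xs⊆ refl
      with m , ys , xs↭ , ys⊆ ← split p xs
      with ≡.trans (weight-↭ xs↭) (weight-replicate-++ m p ys)
    ... | w
      with zs , zs∈ , ys↭zs ← find (complete ps
             (All.map (λ (p≢y , y∈) → Any.tail (p≢y ∘ ≡.sym) (All.lookup xs⊆ y∈)) ys⊆)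
             (≡.sym (≡.trans (cong (_∸ m * size p) w) (ℕ.m+n∸m≡n (m * size p) (weight ys)))))
      = lose
          (∈-concatMap⁺ (block p ps n)
            (lose (∈-filter⁺ (λ m → m * size p ≤? n) (∈-upTo⁺ (s≤s m≤n)) m*p≤n)
                  (∈-map⁺ (replicate m p ++_) zs∈)))
          (↭-trans xs↭ (++⁺ˡ (replicate m p) ys↭zs))
      where
      m*p≤n : m * size p ≤ n
      m*p≤n = subst (m * size p ≤_) (≡.sym w) (ℕ.m≤m+n _ _)
      m≤n : m ≤ n
      m≤n = ℕ.≤-trans (ℕ.m≤m*n m (size p)) m*p≤n

    ++-cancelˡ-↭ : ∀ (xs : List (Part c)) {ys zs} → xs ++ ys ↭ xs ++ zs → ys ↭ zs
    ++-cancelˡ-↭ []       e = e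
    ++-cancelˡ-↭ (x ∷ xs) e = ++-cancelˡ-↭ xs (drop-∷ e)

    multiplicity : Part c → List (Part c) → ℕ
    multiplicity p xs = length (filter (p ≟_) xs)

    multiplicity-replicate-++ : ∀ m {p} {ys : List (Part c)} → All (p ≢_) ys →
                                multiplicity p (replicate m p ++ ys) ≡ m
    multiplicity-replicate-++ m {p} {ys} p∉ys
      rewrite filter-++ (p ≟_) (replicate m p) ys
            | filter-all (p ≟_) (All.replicate⁺ {P = p ≡_} m refl)
            | filter-none (p ≟_) p∉ys
            | ++-identityʳ (replicate m p)
      = length-replicate m

    block-multiplicity : ∀ {p ps n m} → All (p ≢_) ps → ∀ {xs} → xs ∈ block p ps n m → multiplicity p xs ≡ m
    block-multiplicity {p} {ps} {n} {m} p∉ps xs∈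
      with ys , ys∈ , refl ← ∈-map⁻ (replicate m p ++_) xs∈
      = multiplicity-replicate-++ m (All.map (All.lookup p∉ps) (proj₁ (sound ps ys∈)))

    enumerate-unique : ∀ {ps} → Unique ps → ∀ n → SetoidUnique.Unique Lists (enumerate ps n)
    enumerate-unique []               zero    = [] ∷ []
    enumerate-unique []               (suc _) = []
    enumerate-unique {p ∷ ps} (p∉ps ∷ ps!) n =
      SetoidUnique.concat⁺ Lists
        (All.map⁺ (All.universal (λ m → SetoidUnique.map⁺ Lists Lists (++-cancelˡ-↭ (replicate m p))
                                          (enumerate-unique ps! (n ∸ m * size p))) _))
        (AllPairs.map⁺ (AllPairs.map disjoint
          (Unique.filter⁺ (λ m → m * size p ≤? n) (Unique.upTo⁺ (suc n)))))
      where
      disjoint : ∀ {m m′} → m ≢ m′ → ∀ {xs} →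
                 ¬ (Any (xs ↭_) (block p ps n m) × Any (xs ↭_) (block p ps n m′))
      disjoint m≢m′ (xs∈ , xs∈′)
        with ys , ys∈ , e ← find xs∈ | zs , zs∈ , e′ ← find xs∈′
        = m≢m′ (≡.trans (≡.sym (block-multiplicity p∉ps ys∈))
                 (≡.trans (↭-length (filter-↭ (p ≟_) (↭-trans (↭-sym e) e′)))
                   (block-multiplicity p∉ps zs∈)))

  partsUpTo-unique : ∀ c n → Unique (partsUpTo c n)
  partsUpTo-unique c n = Unique.concat⁺
    (All.map⁺ (All.universal (λ k → Unique.map⁺ (λ { refl → refl }) (Unique.allFin⁺ (c (suc k)))) _))
    (AllPairs.map⁺ (AllPairs.map disjoint (Unique.upTo⁺ n)))
    where
    size≡ : ∀ {k v} → v ∈ map (part (suc k)) (allFin (c (suc k))) → size v ≡ suc k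
    size≡ {k} v∈ with _ , _ , refl ← ∈-map⁻ (part (suc k)) v∈ = refl

    disjoint : ∀ {k l} → k ≢ l → ∀ {v} →
               ¬ (v ∈ map (part (suc k)) (allFin (c (suc k))) × v ∈ map (part (suc l)) (allFin (c (suc l))))
    disjoint k≢l (v∈ , v∈′) = k≢l (ℕ.suc-injective (≡.trans (≡.sym (size≡ v∈)) (size≡ v∈′)))

  ∈-partsUpTo : ∀ c n (p : Part c) → size p ≤ n → p ∈ partsUpTo c n
  ∈-partsUpTo c n (part (suc k) i) k<n = ∈-concatMap⁺ (λ k → map (part (suc k)) (allFin (c (suc k))))
    (lose (∈-upTo⁺ k<n) (∈-map⁺ (part (suc k)) (∈-allFin i)))

  parts≤weight : ∀ {c} (xs : List (Part c)) → All (λ p → size p ≤ weight xs) xs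
  parts≤weight []       = []
  parts≤weight (x ∷ xs) =
    ℕ.m≤m+n _ _ ∷ All.map (λ le → ℕ.≤-trans le (ℕ.m≤n+m _ (size x))) (parts≤weight xs)

countPartitions-correct : ∀ c n → Inverse (≡.setoid (Fin (countPartitions c n))) (Partition c n)
countPartitions-correct c n = record
  { to        = to
  ; from      = index ∘ find↭
  ; to-cong   = λ { refl → ↭-refl }
  ; from-cong = λ {x} {y} x↭y → injective _ _
      (↭-trans (↭-sym (lookup-index (find↭ x))) (↭-trans x↭y (lookup-index (find↭ y))))
  ; inverse   = (λ { {x} refl → ↭-sym (lookup-index (find↭ x)) })
              , (λ {i} {x} x↭ → injective _ _ (↭-trans (↭-sym (lookup-index (find↭ x))) x↭))
  }
  where
  open Setoid (Partition c n) using (Carrier)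

  to : Fin (countPartitions c n) → Carrier
  to i = lookup (partitions c n) i , proj₂ (sound (partsUpTo c n) (∈-lookup i))

  find↭ : (x : Carrier) → Any (proj₁ x ↭_) (partitions c n)
  find↭ (xs , refl) = complete (partsUpTo c n) (All.map (∈-partsUpTo c n _) (parts≤weight xs)) refl

  injective : ∀ i j → lookup (partitions c n) i ↭ lookup (partitions c n) j → i ≡ j
  injective = lookup-injective (↭-setoid {A = Part c}) (enumerate-unique (partsUpTo-unique c n) n)

{-# OPTIONS --safe #-}
-- Put [r] = (q^r, q^(76−r); q^76)_∞.  After clearing denominators the claim is
--   [18][20] ([37]² + q^18 [1]²) = [36][38] [19]²,
-- a case of Weierstrass' three-term relation.  The Jacobi triple product turns
-- [37] and [1] into Σ (−1)^m q^(38m²+m) and Σ (−1)^m q^(38m²−37m) (up to the factor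
-- (q^76; q^76)_∞).  In the double sums for the two squares substitute
-- (s, d) = (m + n, m − n) and (m + n − 1, m − n): both summands become
-- (−1)^d q^(19s²+s+19d²), the first over s ≡ d and the second over s ≢ d (mod 2).
-- Together they give Σ q^(19s²+s) · Σ (−1)^d q^(19d²), and the triple product in base
-- q^38 turns this into the right-hand side.
module Submission where

open import Defs
open import Data.Nat using (ℕ; _+_; _∸_; _≤_)
open import Relation.Binary.PropositionalEquality using (_≡_)
open import Algebra.Bundles using (CommutativeMonoid; CommutativeRing)
import Algebra.Properties.CommutativeSemigroup as CommutativeSemigroupProperties
import Algebra.Properties.Ring as RingProperties
import Algebra.Properties.Semiring.Exp as Exp
import Algebra.Solver.Ring.NaturalCoefficients.Default as SemiringSolver
open import Data.Bool using (if_then_else_)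
open import Data.Integer as ℤ using (ℤ; +_; -[1+_]; _⊖_; ∣_∣)
import Data.Integer.Properties as ℤ
import Data.Integer.Tactic.RingSolver as ℤSolver
open import Data.List using (List; []; _∷_; _++_; _∷ʳ_; map; foldr; concatMap; filter; length; replicate; upTo; applyUpTo; allFin)
open import Data.List.Properties using (++-identityʳ; concatMap-cong; filter-++; filter-accept; filter-reject; length-++; length-map; length-tabulate; map-concatMap; map-replicate; map-upTo; map-∘; upTo-∷ʳ)
open import Data.List.Relation.Unary.All as All using (All; []; _∷_)
import Data.Nat as ℕ
open import Data.Nat using (zero; suc; _<_; s≤s; z≤n; _≤?_)
open import Data.Nat.Divisibility using (_∣_; _∣?_; ∣-refl; ∣m∣n⇒∣m+n; ∣m+n∣m⇒∣n)
import Data.Nat.Properties as ℕ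
import Data.Nat.Tactic.RingSolver as ℕSolver
open import Data.Product using (∃-syntax; _×_; _,_; proj₁; proj₂)
open import Data.Sum using (_⊎_; inj₁; inj₂)
open import Function using (_∘_; id)
open import Level using (0ℓ)
open import Relation.Binary.PropositionalEquality as ≡ using (refl; cong; cong₂; subst; subst₂)
import Relation.Binary.Reasoning.Setoid as SetoidReasoning
open import Relation.Nullary using (Dec; yes; no; ⌊_⌋; contradiction; from-yes)

-- No limits are taken. For a fixed n all work happens in a commutative ring in which q^N ≈ 0,
-- finally used with N = n + 1. Bilateral series become sums over finite windows and infinite
-- products become products of K factors. Convergence turns into the demand that windows be wide
-- enough, and each reindexing of a sum has to pay for its shift with a wider window. The triple
-- product comes from its finite form with Gaussian binomials, which modulo q^N turn into the
-- inverse of (x; x)_∞ as soon as both lower indices reach N. Nothing is ever divided: a generating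
-- function G is known only through G ⊗ P ≈ 1. A second obstacle is that `partitions c n` cuts its
-- list of parts at n, so the counts for different n do not belong to one list. Parts larger than n
-- do not affect the coefficient of X^n, and this allows one common list with all parts up to 76 K.

module BigOp (M : CommutativeMonoid 0ℓ 0ℓ) where
  open CommutativeMonoid M renaming (refl to ≈-refl)
  open CommutativeSemigroupProperties commutativeSemigroup using (interchange)

  fold : ℕ → (ℕ → Carrier) → Carrier
  fold zero    f = ε
  fold (suc n) f = f 0 ∙ fold n (f ∘ suc)

  fold-cong : ∀ n {f g} → (∀ k → k < n → f k ≈ g k) → fold n f ≈ fold n g
  fold-cong zero    f≈g = ≈-refl
  fold-cong (suc n) f≈g = ∙-cong (f≈g 0 (s≤s z≤n)) (fold-cong n (λ k k<n → f≈g (suc k) (s≤s k<n)))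

  fold-ε : ∀ n {f} → (∀ k → k < n → f k ≈ ε) → fold n f ≈ ε
  fold-ε zero    f≈ε = ≈-refl
  fold-ε (suc n) f≈ε = trans (∙-cong (f≈ε 0 (s≤s z≤n)) (fold-ε n (λ k k<n → f≈ε (suc k) (s≤s k<n)))) (identityˡ ε)

  fold-∙ : ∀ n f g → fold n (λ k → f k ∙ g k) ≈ fold n f ∙ fold n g
  fold-∙ zero    f g = sym (identityˡ ε)
  fold-∙ (suc n) f g = trans (∙-congˡ (fold-∙ n (f ∘ suc) (g ∘ suc))) (interchange _ _ _ _)

  fold-+ : ∀ m n f → fold (m + n) f ≈ fold m f ∙ fold n (λ k → f (m + k))
  fold-+ zero    n f = sym (identityˡ _)
  fold-+ (suc m) n f = trans (∙-congˡ (fold-+ m n (f ∘ suc))) (sym (assoc _ _ _))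

  fold-suc : ∀ n f → fold (suc n) f ≈ fold n f ∙ f n
  fold-suc zero    f = comm _ _
  fold-suc (suc n) f = trans (∙-congˡ (fold-suc n (f ∘ suc))) (sym (assoc _ _ _))

  fold-swap : ∀ m n (f : ℕ → ℕ → Carrier) →
              fold m (λ i → fold n (λ j → f i j)) ≈ fold n (λ j → fold m (λ i → f i j))
  fold-swap zero    n f = sym (fold-ε n (λ _ _ → ≈-refl))
  fold-swap (suc m) n f = trans (∙-congˡ (fold-swap m n (f ∘ suc))) (sym (fold-∙ n (f 0) _))

  fold-parity : ∀ n f → fold (n ℕ.* 2) f ≈ fold n (λ k → f (k ℕ.* 2) ∙ f (suc (k ℕ.* 2)))
  fold-parity zero    f = ≈-refl
  fold-parity (suc n) f = trans (∙-congˡ (∙-congˡ (fold-parity n (f ∘ suc ∘ suc)))) (sym (assoc _ _ _))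

  fold-cutoff : ∀ {m n f} → m ≤ n → (∀ k → m ≤ k → f k ≈ ε) → fold n f ≈ fold m f
  fold-cutoff {m} {n} {f} m≤n f≈ε =
    trans (reflexive (cong (λ n → fold n f) (≡.sym (ℕ.m+[n∸m]≡n m≤n))))
      (trans (fold-+ m (n ∸ m) f)
        (trans (∙-congˡ (fold-ε (n ∸ m) (λ k _ → f≈ε (m + k) (ℕ.m≤m+n m k)))) (identityʳ _)))

  fold-blocks : ∀ n w f → fold (n ℕ.* w) f ≈ fold n (λ j → fold w (λ k → f (j ℕ.* w + k)))
  fold-blocks zero    w f = ≈-refl
  fold-blocks (suc n) w f = trans (fold-+ w (n ℕ.* w) f) (∙-congˡ (trans (fold-blocks n w (λ k → f (w + k)))
    (fold-cong n (λ j _ → fold-cong w (λ k _ → reflexive (cong f (≡.sym (ℕ.+-assoc w (j ℕ.* w) k))))))))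

-- Integer indices as differences of naturals, and the exponents of theta series.

n*2≡n+n : ∀ n → n ℕ.* 2 ≡ n + n
n*2≡n+n = ℕSolver.solve-∀

[m+n]⊖m : ∀ m n → (m + n) ⊖ m ≡ + n
[m+n]⊖m m n = ≡.trans (ℤ.⊖-≥ (ℕ.m≤m+n m n)) (cong +_ (ℕ.m+n∸m≡n m n))

m⊖[m+n] : ∀ m n → m ⊖ (m + n) ≡ ℤ.- + n
m⊖[m+n] m n = ≡.trans (ℤ.⊖-≤ (ℕ.m≤m+n m n)) (cong (λ k → ℤ.- + k) (ℕ.m+n∸m≡n m n))

∣⊖∣-≥ : ∀ {m n N} → m + N ≤ n ⊎ n + N ≤ m → N ≤ ∣ m ⊖ n ∣
∣⊖∣-≥ {m} {n} {N} (inj₁ m+N≤n) = subst (N ≤_) (≡.sym (ℤ.∣⊖∣-≤ (ℕ.m+n≤o⇒m≤o m m+N≤n))) (ℕ.m+n≤o⇒m≤o∸n N (subst (_≤ n) (ℕ.+-comm m N) m+N≤n))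
∣⊖∣-≥ {m} {n} {N} (inj₂ n+N≤m) =
  subst (N ≤_) (ℤ.∣m⊖n∣≡∣n⊖m∣ n m) (∣⊖∣-≥ {n} {m} (inj₁ n+N≤m))

-- An index within N of the right end 2K is still at distance at least N from the centre K. This is
-- one of the two places where the triple product needs N * 2 ≤ K; the left end is the other.
deficit-≤ : ∀ {k K N} → N ℕ.* 2 ≤ K → k ≤ K ℕ.* 2 → K ℕ.* 2 ∸ k ≤ N → K + N ≤ k
deficit-≤ {k} {K} {N} 2N≤K k≤2K deficit≤N = ℕ.+-cancelʳ-≤ (K ℕ.* 2 ∸ k) _ _ (begin
  K + N + (K ℕ.* 2 ∸ k) ≤⟨ ℕ.+-monoʳ-≤ (K + N) deficit≤N ⟩
  K + N + N             ≡⟨ ℕ.+-assoc K N N ⟩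
  K + (N + N)           ≤⟨ ℕ.+-monoʳ-≤ K (subst (_≤ K) (n*2≡n+n N) 2N≤K) ⟩
  K + K                 ≡⟨ n*2≡n+n K ⟨
  K ℕ.* 2               ≡⟨ ℕ.m+[n∸m]≡n k≤2K ⟨
  k + (K ℕ.* 2 ∸ k)     ∎)
  where open ℕ.≤-Reasoning

m*2⊖n*2 : ∀ m n → m ℕ.* 2 ⊖ n ℕ.* 2 ≡ (m ⊖ n) ℤ.+ (m ⊖ n)
m*2⊖n*2 m n = begin
  m ℕ.* 2 ⊖ n ℕ.* 2                 ≡⟨ ℤ.m-n≡m⊖n (m ℕ.* 2) (n ℕ.* 2) ⟨
  + (m ℕ.* 2) ℤ.- + (n ℕ.* 2)       ≡⟨ cong₂ ℤ._-_ (ℤ.pos-* m 2) (ℤ.pos-* n 2) ⟩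
  + m ℤ.* + 2 ℤ.- + n ℤ.* + 2       ≡⟨ distributes (+ m) (+ n) ⟩
  (+ m ℤ.- + n) ℤ.+ (+ m ℤ.- + n)   ≡⟨ cong₂ ℤ._+_ (ℤ.m-n≡m⊖n m n) (ℤ.m-n≡m⊖n m n) ⟩
  (m ⊖ n) ℤ.+ (m ⊖ n)               ∎
  where
  open ≡.≡-Reasoning
  distributes : ∀ i j → i ℤ.* + 2 ℤ.- j ℤ.* + 2 ≡ (i ℤ.- j) ℤ.+ (i ℤ.- j)
  distributes = ℤSolver.solve-∀

-- This is u n + w n(n-1)/2, given by its increments: the ratio of successive theta terms is then
-- read off by unfolding, and nothing has to be halved.
halfExponent : ℕ → ℕ → ℕ → ℕ
halfExponent w u zero    = 0
halfExponent w u (suc n) = u + n ℕ.* w + halfExponent w u n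

-- thetaExponent u v n = u n(n+1)/2 + v n(n−1)/2
thetaExponent : ℕ → ℕ → ℤ → ℕ
thetaExponent u v (+ n)    = halfExponent (u + v) u n
thetaExponent u v -[1+ n ] = halfExponent (u + v) v (suc n)

n≤halfExponent : ∀ w {u} n → 1 ≤ u → n ≤ halfExponent w u n
n≤halfExponent w         zero    1≤u = z≤n
n≤halfExponent w {u} (suc n) 1≤u = ℕ.+-mono-≤ (ℕ.m≤n⇒m≤n+o (n ℕ.* w) 1≤u) (n≤halfExponent w n 1≤u)

∣n∣≤thetaExponent : ∀ {u v} i → 1 ≤ u → 1 ≤ v → ∣ i ∣ ≤ thetaExponent u v i
∣n∣≤thetaExponent (+ n)    1≤u 1≤v = n≤halfExponent _ n 1≤u
∣n∣≤thetaExponent -[1+ n ] 1≤u 1≤v = n≤halfExponent _ (suc n) 1≤v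

thetaExponent-neg : ∀ u v n → thetaExponent u v (ℤ.- + n) ≡ halfExponent (u + v) v n
thetaExponent-neg u v zero    = refl
thetaExponent-neg u v (suc n) = refl

-- Doubling and passing to ℤ makes the exponents polynomials, so that the ring solver can compare
-- them.
halfExponent-quadratic : ∀ w u n → + 2 ℤ.* + halfExponent w u n ≡ + w ℤ.* (+ n ℤ.* + n ℤ.- + n) ℤ.+ + 2 ℤ.* (+ u ℤ.* + n)
halfExponent-quadratic w u zero    = zero-case (+ w) (+ u)
  where
  zero-case : ∀ w u → + 0 ≡ w ℤ.* (+ 0 ℤ.* + 0 ℤ.- + 0) ℤ.+ + 2 ℤ.* (u ℤ.* + 0)
  zero-case = ℤSolver.solve-∀
halfExponent-quadratic w u (suc n) = begin
  + 2 ℤ.* (+ u ℤ.+ + (n ℕ.* w) ℤ.+ + halfExponent w u n)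
    ≡⟨ cong (λ p → + 2 ℤ.* (+ u ℤ.+ p ℤ.+ + halfExponent w u n)) (ℤ.pos-* n w) ⟩
  + 2 ℤ.* (+ u ℤ.+ + n ℤ.* + w ℤ.+ + halfExponent w u n)
    ≡⟨ ℤ.*-distribˡ-+ (+ 2) (+ u ℤ.+ + n ℤ.* + w) (+ halfExponent w u n) ⟩
  + 2 ℤ.* (+ u ℤ.+ + n ℤ.* + w) ℤ.+ + 2 ℤ.* + halfExponent w u n
    ≡⟨ cong (λ e → + 2 ℤ.* (+ u ℤ.+ + n ℤ.* + w) ℤ.+ e) (halfExponent-quadratic w u n) ⟩
  + 2 ℤ.* (+ u ℤ.+ + n ℤ.* + w) ℤ.+ (+ w ℤ.* (+ n ℤ.* + n ℤ.- + n) ℤ.+ + 2 ℤ.* (+ u ℤ.* + n))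
    ≡⟨ step (+ w) (+ u) (+ n) ⟩
  + w ℤ.* (+ suc n ℤ.* + suc n ℤ.- + suc n) ℤ.+ + 2 ℤ.* (+ u ℤ.* + suc n)
    ∎
  where
  open ≡.≡-Reasoning
  step : ∀ w u n → + 2 ℤ.* (u ℤ.+ n ℤ.* w) ℤ.+ (w ℤ.* (n ℤ.* n ℤ.- n) ℤ.+ + 2 ℤ.* (u ℤ.* n)) ≡
                   w ℤ.* ((+ 1 ℤ.+ n) ℤ.* (+ 1 ℤ.+ n) ℤ.- (+ 1 ℤ.+ n)) ℤ.+ + 2 ℤ.* (u ℤ.* (+ 1 ℤ.+ n))
  step = ℤSolver.solve-∀

thetaExponent-quadratic : ∀ u v i → + 2 ℤ.* + thetaExponent u v i ≡
                          (+ u ℤ.+ + v) ℤ.* (i ℤ.* i) ℤ.+ (+ u ℤ.- + v) ℤ.* i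
thetaExponent-quadratic u v (+ n) = ≡.trans (halfExponent-quadratic (u + v) u n) (positive (+ u) (+ v) (+ n))
  where
  positive : ∀ u v n → (u ℤ.+ v) ℤ.* (n ℤ.* n ℤ.- n) ℤ.+ + 2 ℤ.* (u ℤ.* n) ≡
                       (u ℤ.+ v) ℤ.* (n ℤ.* n) ℤ.+ (u ℤ.- v) ℤ.* n
  positive = ℤSolver.solve-∀
thetaExponent-quadratic u v -[1+ n ] =
  ≡.trans (halfExponent-quadratic (u + v) v (suc n)) (negative (+ u) (+ v) (+ suc n))
  where
  negative : ∀ u v n → (u ℤ.+ v) ℤ.* (n ℤ.* n ℤ.- n) ℤ.+ + 2 ℤ.* (v ℤ.* n) ≡
                       (u ℤ.+ v) ℤ.* ((ℤ.- n) ℤ.* (ℤ.- n)) ℤ.+ (u ℤ.- v) ℤ.* (ℤ.- n)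
  negative = ℤSolver.solve-∀

2*-injective : ∀ {m n} → + 2 ℤ.* + m ≡ + 2 ℤ.* + n → m ≡ n
2*-injective {m} {n} eq = ℤ.+-injective (ℤ.*-cancelˡ-≡ (+ 2) (+ m) (+ n) eq)

-- The parallelogram identity 2(m² + n²) = (m + n)² + (m - n)². The idle `- + 0` gives this the same
-- shape as the odd case below, so that one reindexing lemma serves both.
thetaExponent-φ : ∀ m n → thetaExponent 39 37 m + thetaExponent 39 37 n ≡
                  thetaExponent 20 18 (m ℤ.+ n ℤ.- + 0) + thetaExponent 19 19 (m ℤ.- n)
thetaExponent-φ m n = 2*-injective (begin
  + 2 ℤ.* (+ thetaExponent 39 37 m ℤ.+ + thetaExponent 39 37 n)
    ≡⟨ ℤ.*-distribˡ-+ (+ 2) (+ thetaExponent 39 37 m) (+ thetaExponent 39 37 n) ⟩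
  + 2 ℤ.* + thetaExponent 39 37 m ℤ.+ + 2 ℤ.* + thetaExponent 39 37 n
    ≡⟨ cong₂ ℤ._+_ (thetaExponent-quadratic 39 37 m) (thetaExponent-quadratic 39 37 n) ⟩
  (+ 76 ℤ.* (m ℤ.* m) ℤ.+ + 2 ℤ.* m) ℤ.+ (+ 76 ℤ.* (n ℤ.* n) ℤ.+ + 2 ℤ.* n)
    ≡⟨ quadratic m n ⟩
  (+ 38 ℤ.* ((m ℤ.+ n ℤ.- + 0) ℤ.* (m ℤ.+ n ℤ.- + 0)) ℤ.+ + 2 ℤ.* (m ℤ.+ n ℤ.- + 0)) ℤ.+
    (+ 38 ℤ.* ((m ℤ.- n) ℤ.* (m ℤ.- n)) ℤ.+ + 0 ℤ.* (m ℤ.- n))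
    ≡⟨ cong₂ ℤ._+_ (thetaExponent-quadratic 20 18 (m ℤ.+ n ℤ.- + 0)) (thetaExponent-quadratic 19 19 (m ℤ.- n)) ⟨
  + 2 ℤ.* + thetaExponent 20 18 (m ℤ.+ n ℤ.- + 0) ℤ.+ + 2 ℤ.* + thetaExponent 19 19 (m ℤ.- n)
    ≡⟨ ℤ.*-distribˡ-+ (+ 2) (+ thetaExponent 20 18 (m ℤ.+ n ℤ.- + 0)) (+ thetaExponent 19 19 (m ℤ.- n)) ⟨
  + 2 ℤ.* (+ thetaExponent 20 18 (m ℤ.+ n ℤ.- + 0) ℤ.+ + thetaExponent 19 19 (m ℤ.- n))
    ∎)
  where
  open ≡.≡-Reasoning
  quadratic : ∀ m n →
    (+ 76 ℤ.* (m ℤ.* m) ℤ.+ + 2 ℤ.* m) ℤ.+ (+ 76 ℤ.* (n ℤ.* n) ℤ.+ + 2 ℤ.* n) ≡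
    (+ 38 ℤ.* ((m ℤ.+ n ℤ.- + 0) ℤ.* (m ℤ.+ n ℤ.- + 0)) ℤ.+ + 2 ℤ.* (m ℤ.+ n ℤ.- + 0)) ℤ.+
    (+ 38 ℤ.* ((m ℤ.- n) ℤ.* (m ℤ.- n)) ℤ.+ + 0 ℤ.* (m ℤ.- n))
  quadratic = ℤSolver.solve-∀

-- The origin of the shift by 18: expanding 19s² + s at s = m + n - 1 leaves the constant 19 - 1,
-- and the linear coefficient becomes 1 - 38 = -37.
thetaExponent-ψ : ∀ m n → 18 + (thetaExponent 1 75 m + thetaExponent 1 75 n) ≡
                  thetaExponent 20 18 (m ℤ.+ n ℤ.- + 1) + thetaExponent 19 19 (m ℤ.- n)
thetaExponent-ψ m n = 2*-injective (begin
  + 2 ℤ.* (+ 18 ℤ.+ (+ thetaExponent 1 75 m ℤ.+ + thetaExponent 1 75 n))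
    ≡⟨ distributes (+ thetaExponent 1 75 m) (+ thetaExponent 1 75 n) ⟩
  + 36 ℤ.+ (+ 2 ℤ.* + thetaExponent 1 75 m ℤ.+ + 2 ℤ.* + thetaExponent 1 75 n)
    ≡⟨ cong (λ e → + 36 ℤ.+ e) (cong₂ ℤ._+_ (thetaExponent-quadratic 1 75 m) (thetaExponent-quadratic 1 75 n)) ⟩
  + 36 ℤ.+ ((+ 76 ℤ.* (m ℤ.* m) ℤ.+ -[1+ 73 ] ℤ.* m) ℤ.+ (+ 76 ℤ.* (n ℤ.* n) ℤ.+ -[1+ 73 ] ℤ.* n))
    ≡⟨ quadratic m n ⟩
  (+ 38 ℤ.* ((m ℤ.+ n ℤ.- + 1) ℤ.* (m ℤ.+ n ℤ.- + 1)) ℤ.+ + 2 ℤ.* (m ℤ.+ n ℤ.- + 1)) ℤ.+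
    (+ 38 ℤ.* ((m ℤ.- n) ℤ.* (m ℤ.- n)) ℤ.+ + 0 ℤ.* (m ℤ.- n))
    ≡⟨ cong₂ ℤ._+_ (thetaExponent-quadratic 20 18 (m ℤ.+ n ℤ.- + 1)) (thetaExponent-quadratic 19 19 (m ℤ.- n)) ⟨
  + 2 ℤ.* + thetaExponent 20 18 (m ℤ.+ n ℤ.- + 1) ℤ.+ + 2 ℤ.* + thetaExponent 19 19 (m ℤ.- n)
    ≡⟨ ℤ.*-distribˡ-+ (+ 2) (+ thetaExponent 20 18 (m ℤ.+ n ℤ.- + 1)) (+ thetaExponent 19 19 (m ℤ.- n)) ⟨
  + 2 ℤ.* (+ thetaExponent 20 18 (m ℤ.+ n ℤ.- + 1) ℤ.+ + thetaExponent 19 19 (m ℤ.- n))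
    ∎)
  where
  open ≡.≡-Reasoning
  distributes : ∀ i j → + 2 ℤ.* (+ 18 ℤ.+ (i ℤ.+ j)) ≡ + 36 ℤ.+ (+ 2 ℤ.* i ℤ.+ + 2 ℤ.* j)
  distributes = ℤSolver.solve-∀
  quadratic : ∀ m n →
    + 36 ℤ.+ ((+ 76 ℤ.* (m ℤ.* m) ℤ.+ -[1+ 73 ] ℤ.* m) ℤ.+ (+ 76 ℤ.* (n ℤ.* n) ℤ.+ -[1+ 73 ] ℤ.* n)) ≡
    (+ 38 ℤ.* ((m ℤ.+ n ℤ.- + 1) ℤ.* (m ℤ.+ n ℤ.- + 1)) ℤ.+ + 2 ℤ.* (m ℤ.+ n ℤ.- + 1)) ℤ.+
    (+ 38 ℤ.* ((m ℤ.- n) ℤ.* (m ℤ.- n)) ℤ.+ + 0 ℤ.* (m ℤ.- n))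
  quadratic = ℤSolver.solve-∀

copies : (ℕ → ℕ) → ℕ → List ℕ
copies c k = replicate (c (suc k)) (suc k)

-- These are the exponents r of the factors 1 - q^r in the denominator of the generating function.
sizes : (ℕ → ℕ) → ℕ → List ℕ
sizes c n = concatMap (copies c) (upTo n)

-- Gaussian binomials and the Jacobi triple product in a commutative ring.

module JacobiTripleProduct (R : CommutativeRing 0ℓ 0ℓ) where
  open CommutativeRing R renaming (_+_ to _⊕_; _*_ to _⊗_; refl to ≈-refl; -_ to ⊝_) hiding (_-_; zero)
  open BigOp +-commutativeMonoid public using () renaming
    (fold to ∑; fold-cong to ∑-cong; fold-ε to ∑-0; fold-∙ to ∑-⊕; fold-+ to ∑-+; fold-suc to ∑-suc;
     fold-swap to ∑-swap; fold-parity to ∑-parity; fold-cutoff to ∑-cutoff)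
  open BigOp *-commutativeMonoid public using () renaming
    (fold to ∏; fold-cong to ∏-cong; fold-ε to ∏-1; fold-∙ to ∏-⊗; fold-suc to ∏-suc;
     fold-parity to ∏-parity; fold-cutoff to ∏-cutoff; fold-blocks to ∏-blocks)
  open Exp semiring public using (_^_; ^-homo-*; ^-assocʳ; ^-congˡ; ^-congʳ)
  open RingProperties ring using (-1*x≈-x; -‿involutive)
  open SemiringSolver commutativeSemiring using (solve; _:+_; _:*_; _:=_; con)
  open SetoidReasoning setoid

  -- Minus one is an opaque variable for the semiring solver. Solver steps therefore leave a factor
  -- `1# ⊕ -1#`, which `1⊕-1` removes.
  -1# : Carrier
  -1# = ⊝ 1#

  1⊕-1 : 1# ⊕ -1# ≈ 0#
  1⊕-1 = -‿inverseʳ 1#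

  -1⊗-1 : -1# ⊗ -1# ≈ 1#
  -1⊗-1 = trans (-1*x≈-x -1#) (-‿involutive 1#)

  ∑-distribˡ : ∀ n c f → c ⊗ ∑ n f ≈ ∑ n (λ k → c ⊗ f k)
  ∑-distribˡ zero    c f = zeroʳ c
  ∑-distribˡ (suc n) c f = trans (distribˡ c _ _) (+-congˡ (∑-distribˡ n c (f ∘ suc)))

  ^-vanish : ∀ {x N m} → x ^ N ≈ 0# → N ≤ m → x ^ m ≈ 0#
  ^-vanish {x} {N} {m} xᴺ≈0 N≤m = begin
    x ^ m               ≡⟨ cong (x ^_) (ℕ.m+[n∸m]≡n N≤m) ⟨
    x ^ (N + (m ∸ N))   ≈⟨ ^-homo-* x N (m ∸ N) ⟩
    x ^ N ⊗ x ^ (m ∸ N) ≈⟨ *-congʳ xᴺ≈0 ⟩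
    0# ⊗ x ^ (m ∸ N)    ≈⟨ zeroˡ _ ⟩
    0#                  ∎


  module Gaussian (x : Carrier) where

    -- The Gaussian binomial coefficient in base x. Taking a q-Pascal rule as the definition avoids
    -- division by 1 - x^k.
    binomial : ℕ → ℕ → Carrier
    binomial m       zero    = 1#
    binomial zero    (suc k) = 0#
    binomial (suc m) (suc k) = binomial m k ⊕ x ^ suc k ⊗ binomial m (suc k)

    binomial-> : ∀ {m k} → m < k → binomial m k ≈ 0#
    binomial-> {zero}  {suc k} _         = ≈-refl
    binomial-> {suc m} {suc k} (s≤s m<k) = begin
      binomial m k ⊕ x ^ suc k ⊗ binomial m (suc k) ≈⟨ +-cong (binomial-> m<k) (*-congˡ (binomial-> (ℕ.m≤n⇒m≤1+n m<k))) ⟩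
      0# ⊕ x ^ suc k ⊗ 0#                           ≈⟨ trans (+-identityˡ _) (zeroʳ _) ⟩
      0#                                            ∎

    -- The mirror image of the defining q-Pascal rule, with the upper index written i + j so that
    -- the exponent needs no subtraction. In the inductive step both terms are expanded by the
    -- mirrored rule, and regrouping restores the defining rule.
    pascal : ∀ i j → binomial (suc (i + j)) (suc i) ≈ binomial (i + j) (suc i) ⊕ x ^ j ⊗ binomial (i + j) i
    pascal i zero rewrite ℕ.+-identityʳ i = begin
      binomial i i ⊕ x ^ suc i ⊗ binomial i (suc i) ≈⟨ +-congˡ (trans (*-congˡ (binomial-> (ℕ.n<1+n i))) (zeroʳ _)) ⟩
      binomial i i ⊕ 0#                             ≈⟨ +-comm _ _ ⟩
      0# ⊕ binomial i i                             ≈⟨ +-cong (binomial-> (ℕ.n<1+n i)) (*-identityˡ _) ⟨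
      binomial i (suc i) ⊕ 1# ⊗ binomial i i        ∎
    pascal zero (suc j) = begin
      1# ⊕ x ^ 1 ⊗ binomial (suc j) 1
        ≈⟨ +-congˡ (*-congˡ (pascal zero j)) ⟩
      1# ⊕ x ⊗ 1# ⊗ (binomial j 1 ⊕ x ^ j ⊗ 1#)
        ≈⟨ solve 3 (λ x B xʲ → con 1 :+ x :* con 1 :* (B :+ xʲ :* con 1) :=
             con 1 :+ x :* con 1 :* B :+ x :* xʲ :* con 1) ≈-refl x (binomial j 1) (x ^ j) ⟩
      (1# ⊕ x ⊗ 1# ⊗ binomial j 1) ⊕ x ⊗ x ^ j ⊗ 1#
        ∎
    pascal (suc i) (suc j) = begin
      binomial (suc (i + suc j)) (suc i) ⊕ x ^ suc (suc i) ⊗ binomial (suc (i + suc j)) (suc (suc i))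
        ≈⟨ +-cong (pascal i (suc j)) (*-congˡ shifted) ⟩
      (binomial (i + suc j) (suc i) ⊕ x ^ suc j ⊗ binomial (i + suc j) i) ⊕
        x ^ suc (suc i) ⊗ (binomial (i + suc j) (suc (suc i)) ⊕ x ^ j ⊗ binomial (i + suc j) (suc i))
        ≈⟨ solve 6 (λ x xⁱ xʲ B₀ B₁ B₂ →
             B₁ :+ x :* xʲ :* B₀ :+ x :* (x :* xⁱ) :* (B₂ :+ xʲ :* B₁) :=
             B₁ :+ x :* (x :* xⁱ) :* B₂ :+ x :* xʲ :* (B₀ :+ x :* xⁱ :* B₁))
             ≈-refl x (x ^ i) (x ^ j) (binomial (i + suc j) i) (binomial (i + suc j) (suc i))
             (binomial (i + suc j) (suc (suc i))) ⟩
      (binomial (i + suc j) (suc i) ⊕ x ^ suc (suc i) ⊗ binomial (i + suc j) (suc (suc i))) ⊕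
        x ^ suc j ⊗ (binomial (i + suc j) i ⊕ x ^ suc i ⊗ binomial (i + suc j) (suc i))
        ∎
      where
      shifted : binomial (suc (i + suc j)) (suc (suc i)) ≈
                binomial (i + suc j) (suc (suc i)) ⊕ x ^ j ⊗ binomial (i + suc j) (suc i)
      shifted rewrite ℕ.+-suc i j = pascal (suc i) j

    -- Subtract x^(i+1) times the mirrored rule from the defining rule: the two contributions of
    -- `binomial (i + j) (suc i)` cancel.
    pascal-difference : ∀ i j → (1# ⊕ -1# ⊗ x ^ suc i) ⊗ binomial (suc (i + j)) (suc i) ≈
                                (1# ⊕ -1# ⊗ x ^ suc (i + j)) ⊗ binomial (i + j) i
    pascal-difference i j = begin
      (1# ⊕ -1# ⊗ x ^ suc i) ⊗ B
        ≈⟨ solve 3 (λ ε p B → (con 1 :+ ε :* p) :* B := B :+ ε :* (p :* B)) ≈-refl -1# (x ^ suc i) B ⟩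
      B ⊕ -1# ⊗ (x ^ suc i ⊗ B)
        ≈⟨ +-congˡ (*-congˡ (*-congˡ (pascal i j))) ⟩
      (B₀ ⊕ x ^ suc i ⊗ B₁) ⊕ -1# ⊗ (x ^ suc i ⊗ (B₁ ⊕ x ^ j ⊗ B₀))
        ≈⟨ solve 5 (λ ε p pⱼ B₀ B₁ → B₀ :+ p :* B₁ :+ ε :* (p :* (B₁ :+ pⱼ :* B₀)) :=
             (con 1 :+ ε :* (p :* pⱼ)) :* B₀ :+ (con 1 :+ ε) :* (p :* B₁))
             ≈-refl -1# (x ^ suc i) (x ^ j) B₀ B₁ ⟩
      (1# ⊕ -1# ⊗ (x ^ suc i ⊗ x ^ j)) ⊗ B₀ ⊕ (1# ⊕ -1#) ⊗ (x ^ suc i ⊗ B₁)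
        ≈⟨ +-cong (*-congʳ (+-congˡ (*-congˡ (sym (^-homo-* x (suc i) j))))) (trans (*-congʳ 1⊕-1) (zeroˡ _)) ⟩
      (1# ⊕ -1# ⊗ x ^ suc (i + j)) ⊗ B₀ ⊕ 0#
        ≈⟨ +-identityʳ _ ⟩
      (1# ⊕ -1# ⊗ x ^ suc (i + j)) ⊗ B₀
        ∎
      where
      B B₀ B₁ : Carrier
      B  = binomial (suc (i + j)) (suc i)
      B₀ = binomial (i + j) i
      B₁ = binomial (i + j) (suc i)

    1-x^1+ : ℕ → Carrier
    1-x^1+ l = 1# ⊕ -1# ⊗ x ^ suc l

    pochhammer : ℕ → Carrier
    pochhammer n = ∏ n 1-x^1+

    -- The quotient formula for Gaussian binomials with its denominator cleared, by iterating
    -- `pascal-difference`.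
    binomial-pochhammer : ∀ i j → pochhammer i ⊗ binomial (i + j) i ≈ ∏ i (λ l → 1-x^1+ (l + j))
    binomial-pochhammer zero    j = *-identityˡ 1#
    binomial-pochhammer (suc i) j = begin
      pochhammer (suc i) ⊗ binomial (suc i + j) (suc i)
        ≈⟨ trans (*-congʳ (∏-suc i _)) (*-assoc _ _ _) ⟩
      pochhammer i ⊗ (1-x^1+ i ⊗ binomial (suc i + j) (suc i))
        ≈⟨ *-congˡ (pascal-difference i j) ⟩
      pochhammer i ⊗ (1-x^1+ (i + j) ⊗ binomial (i + j) i)
        ≈⟨ solve 3 (λ P u B → P :* (u :* B) := P :* B :* u) ≈-refl _ _ _ ⟩
      pochhammer i ⊗ binomial (i + j) i ⊗ 1-x^1+ (i + j)
        ≈⟨ *-congʳ (binomial-pochhammer i j) ⟩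
      ∏ i (λ l → 1-x^1+ (l + j)) ⊗ 1-x^1+ (i + j)
        ≈⟨ ∏-suc i _ ⟨
      ∏ (suc i) (λ l → 1-x^1+ (l + j))
        ∎

    -- Summation by parts: a Pascal rule with weights u and v moves a sum from row m + 1 to row m.
    -- The weights are left abstract because the triple product uses both Pascal rules in turn.
    ∑-binomial-step : ∀ m (u v F : ℕ → Carrier) → u 0 ≈ 1# →
      (∀ k → k < suc m → binomial (suc m) (suc k) ≈ u (suc k) ⊗ binomial m (suc k) ⊕ v k ⊗ binomial m k) →
      ∑ (suc (suc m)) (λ k → binomial (suc m) k ⊗ F k) ≈
      ∑ (suc m) (λ k → binomial m k ⊗ (u k ⊗ F k ⊕ v k ⊗ F (suc k)))
    ∑-binomial-step m u v F u₀≈1 rule = begin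
      1# ⊗ F 0 ⊕ ∑ (suc m) (λ k → binomial (suc m) (suc k) ⊗ F (suc k))
        ≈⟨ +-cong (*-congˡ (sym (trans (*-congʳ u₀≈1) (*-identityˡ _))))
                  (∑-cong (suc m) λ k k≤m → trans (*-congʳ (rule k k≤m))
                     (solve 5 (λ u v B B′ F → (u :* B′ :+ v :* B) :* F := B′ :* (u :* F) :+ B :* (v :* F))
                        ≈-refl (u (suc k)) (v k) (binomial m k) (binomial m (suc k)) (F (suc k)))) ⟩
      1# ⊗ (u 0 ⊗ F 0) ⊕ ∑ (suc m) (λ k → left (suc k) ⊕ right k)
        ≈⟨ trans (+-congˡ (∑-⊕ (suc m) (left ∘ suc) right)) (sym (+-assoc _ _ _)) ⟩
      ∑ (suc (suc m)) left ⊕ ∑ (suc m) right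
        ≈⟨ +-congʳ (∑-suc (suc m) left) ⟩
      ∑ (suc m) left ⊕ left (suc m) ⊕ ∑ (suc m) right
        ≈⟨ +-congʳ (trans (+-congˡ (trans (*-congʳ (binomial-> (ℕ.n<1+n m))) (zeroˡ _))) (+-identityʳ _)) ⟩
      ∑ (suc m) left ⊕ ∑ (suc m) right
        ≈⟨ ∑-⊕ (suc m) left right ⟨
      ∑ (suc m) (λ k → left k ⊕ right k)
        ≈⟨ ∑-cong (suc m) (λ k _ → sym (distribˡ (binomial m k) (u k ⊗ F k) (v k ⊗ F (suc k)))) ⟩
      ∑ (suc m) (λ k → binomial m k ⊗ (u k ⊗ F k ⊕ v k ⊗ F (suc k)))
        ∎
      where
      left right : ℕ → Carrier
      left  k = binomial m k ⊗ (u k ⊗ F k)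
      right k = binomial m k ⊗ (v k ⊗ F (suc k))

    ∑-pascal₁ : ∀ m F → ∑ (suc (suc m)) (λ k → binomial (suc m) k ⊗ F k) ≈
                        ∑ (suc m) (λ k → binomial m k ⊗ (x ^ k ⊗ F k ⊕ 1# ⊗ F (suc k)))
    ∑-pascal₁ m F = ∑-binomial-step m (x ^_) (λ _ → 1#) F ≈-refl
      (λ _ _ → trans (+-comm _ _) (+-congˡ (sym (*-identityˡ _))))

    ∑-pascal₂ : ∀ m F → ∑ (suc (suc m)) (λ k → binomial (suc m) k ⊗ F k) ≈
                        ∑ (suc m) (λ k → binomial m k ⊗ (1# ⊗ F k ⊕ x ^ (m ∸ k) ⊗ F (suc k)))
    ∑-pascal₂ m F = ∑-binomial-step m (λ _ → 1#) (λ k → x ^ (m ∸ k)) F ≈-refl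
      λ { k (s≤s k≤m) → trans
            (subst (λ n → binomial (suc n) (suc k) ≈ binomial n (suc k) ⊕ x ^ (m ∸ k) ⊗ binomial n k)
                   (ℕ.m+[n∸m]≡n k≤m) (pascal k (m ∸ k)))
            (+-congʳ (sym (*-identityˡ _))) }

    -- All factors 1 - x^(l+1) with l ≥ N are 1. Hence the Pochhammer product has the same value for
    -- K as for i, and the right-hand side of `binomial-pochhammer` is a product of ones.
    binomial-pochhammer-limit : ∀ {N i j K} → x ^ N ≈ 0# → N ≤ i → N ≤ j → N ≤ K →
                                pochhammer K ⊗ binomial (i + j) i ≈ 1#
    binomial-pochhammer-limit {N} {i} {j} {K} xᴺ≈0 N≤i N≤j N≤K = begin
      pochhammer K ⊗ binomial (i + j) i
        ≈⟨ *-congʳ (trans (∏-cutoff N≤K (λ l → 1-x^1+≈1)) (sym (∏-cutoff N≤i (λ l → 1-x^1+≈1)))) ⟩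
      pochhammer i ⊗ binomial (i + j) i
        ≈⟨ binomial-pochhammer i j ⟩
      ∏ i (λ l → 1-x^1+ (l + j))
        ≈⟨ ∏-1 i (λ l _ → 1-x^1+≈1 (ℕ.≤-trans N≤j (ℕ.m≤n+m j l))) ⟩
      1# ∎
      where
      1-x^1+≈1 : ∀ {l} → N ≤ l → 1-x^1+ l ≈ 1#
      1-x^1+≈1 N≤l = trans (+-congˡ (trans (*-congˡ (^-vanish xᴺ≈0 (ℕ.m≤n⇒m≤1+n N≤l))) (zeroʳ -1#))) (+-identityʳ 1#)

  -- A bilateral sequence with T n = aⁿ⁽ⁿ⁺¹⁾ᐟ² bⁿ⁽ⁿ⁻¹⁾ᐟ², characterised by the
  -- ratios of successive terms; x stands for a b.
  record IsTheta (a b x : Carrier) (T : ℤ → Carrier) : Set where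
    field
      a⊗b   : a ⊗ b ≈ x
      T₀    : T (+ 0) ≈ 1#
      T-suc : ∀ n → T (+ suc n) ≈ a ⊗ x ^ n ⊗ T (+ n)
      T-neg : ∀ n → T (ℤ.- + suc n) ≈ b ⊗ x ^ n ⊗ T (ℤ.- + n)

  module _ {a b x T} (isTheta : IsTheta a b x T) where
    open IsTheta isTheta
    open Gaussian x

    -- For every integer n the ratio of T (n + 1) to T n is a x^n. With n = k - K this may be a
    -- negative power, so both sides carry x^(2K-k), and a x^K remains. For k < K the ratio is
    -- `T-neg` read backwards, using a b = x.
    T-up : ∀ K k → k ≤ K ℕ.* 2 → x ^ (K ℕ.* 2 ∸ k) ⊗ T (suc k ⊖ K) ≈ a ⊗ x ^ K ⊗ T (k ⊖ K)
    T-up K k k≤2K with ℕ.<-≤-connex k K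
    ... | inj₂ K≤k with n , refl ← ℕ.m≤n⇒∃[o]m+o≡n K≤k
                   with m , refl ← ℕ.m≤n⇒∃[o]m+o≡n (ℕ.+-cancelˡ-≤ K _ K (subst (K + n ≤_) (n*2≡n+n K) k≤2K)) = begin
      x ^ ((n + m) ℕ.* 2 ∸ (n + m + n)) ⊗ T (suc (n + m + n) ⊖ (n + m))
        ≡⟨ cong₂ (λ e i → x ^ e ⊗ T i) exponent index ⟩
      x ^ m ⊗ T (+ suc n)
        ≈⟨ *-congˡ (T-suc n) ⟩
      x ^ m ⊗ (a ⊗ x ^ n ⊗ T (+ n))
        ≈⟨ solve 4 (λ a xᵐ xⁿ t → xᵐ :* (a :* xⁿ :* t) := a :* (xⁿ :* xᵐ) :* t) ≈-refl a (x ^ m) (x ^ n) (T (+ n)) ⟩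
      a ⊗ (x ^ n ⊗ x ^ m) ⊗ T (+ n)
        ≈⟨ *-congʳ (*-congˡ (^-homo-* x n m)) ⟨
      a ⊗ x ^ (n + m) ⊗ T (+ n)
        ≡⟨ cong (λ i → a ⊗ x ^ (n + m) ⊗ T i) ([m+n]⊖m (n + m) n) ⟨
      a ⊗ x ^ (n + m) ⊗ T ((n + m + n) ⊖ (n + m))
        ∎
      where
      exponent : (n + m) ℕ.* 2 ∸ (n + m + n) ≡ m
      exponent = ≡.trans (cong (_∸ (n + m + n)) (lemma n m)) (ℕ.m+n∸m≡n (n + m + n) m)
        where
        lemma : ∀ n m → (n + m) ℕ.* 2 ≡ n + m + n + m
        lemma = ℕSolver.solve-∀
      index : suc (n + m + n) ⊖ (n + m) ≡ + suc n
      index = ≡.trans (cong (_⊖ (n + m)) (≡.sym (ℕ.+-suc (n + m) n))) ([m+n]⊖m (n + m) (suc n))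
    ... | inj₁ k<K with n , refl ← ℕ.m≤n⇒∃[o]m+o≡n k<K = begin
      x ^ ((suc k + n) ℕ.* 2 ∸ k) ⊗ T (suc k ⊖ (suc k + n))
        ≡⟨ cong₂ (λ e i → x ^ e ⊗ T i) exponent (m⊖[m+n] (suc k) n) ⟩
      x ^ (1 + (suc k + n) + n) ⊗ T (ℤ.- + n)
        ≈⟨ *-congʳ (trans (^-homo-* x (1 + (suc k + n)) n) (*-congʳ (*-congʳ (sym a⊗b)))) ⟩
      a ⊗ b ⊗ x ^ (suc k + n) ⊗ x ^ n ⊗ T (ℤ.- + n)
        ≈⟨ solve 5 (λ a b p r t → a :* b :* p :* r :* t := a :* p :* (b :* r :* t))
             ≈-refl a b (x ^ (suc k + n)) (x ^ n) (T (ℤ.- + n)) ⟩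
      a ⊗ x ^ (suc k + n) ⊗ (b ⊗ x ^ n ⊗ T (ℤ.- + n))
        ≈⟨ *-congˡ (T-neg n) ⟨
      a ⊗ x ^ (suc k + n) ⊗ T (ℤ.- + suc n)
        ≡⟨ cong (λ i → a ⊗ x ^ (suc k + n) ⊗ T i) index ⟨
      a ⊗ x ^ (suc k + n) ⊗ T (k ⊖ (suc k + n))
        ∎
      where
      exponent : (suc k + n) ℕ.* 2 ∸ k ≡ 1 + (suc k + n) + n
      exponent = ≡.trans (cong (_∸ k) (lemma n k)) (ℕ.m+n∸m≡n k _)
        where
        lemma : ∀ n k → (suc k + n) ℕ.* 2 ≡ k + (1 + (suc k + n) + n)
        lemma = ℕSolver.solve-∀
      index : k ⊖ (suc k + n) ≡ ℤ.- + suc n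
      index = ≡.trans (cong (k ⊖_) (≡.sym (ℕ.+-suc k n))) (m⊖[m+n] k (suc n))

    -- The ratio of T (n - 1) to T n is b x^(-n); for n = k - K the factor x^k again clears the
    -- negative power.
    T-down : ∀ K k → x ^ k ⊗ T (k ⊖ suc K) ≈ b ⊗ x ^ K ⊗ T (k ⊖ K)
    T-down K k with ℕ.<-≤-connex K k
    ... | inj₂ k≤K with n , refl ← ℕ.m≤n⇒∃[o]m+o≡n k≤K = begin
      x ^ k ⊗ T (k ⊖ suc (k + n))
        ≡⟨ cong (λ i → x ^ k ⊗ T i) (≡.trans (cong (k ⊖_) (≡.sym (ℕ.+-suc k n))) (m⊖[m+n] k (suc n))) ⟩
      x ^ k ⊗ T (ℤ.- + suc n)
        ≈⟨ *-congˡ (T-neg n) ⟩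
      x ^ k ⊗ (b ⊗ x ^ n ⊗ T (ℤ.- + n))
        ≈⟨ solve 4 (λ b p r t → p :* (b :* r :* t) := b :* (p :* r) :* t) ≈-refl b (x ^ k) (x ^ n) (T (ℤ.- + n)) ⟩
      b ⊗ (x ^ k ⊗ x ^ n) ⊗ T (ℤ.- + n)
        ≈⟨ *-congʳ (*-congˡ (^-homo-* x k n)) ⟨
      b ⊗ x ^ (k + n) ⊗ T (ℤ.- + n)
        ≡⟨ cong (λ i → b ⊗ x ^ (k + n) ⊗ T i) (m⊖[m+n] k n) ⟨
      b ⊗ x ^ (k + n) ⊗ T (k ⊖ (k + n))
        ∎
    ... | inj₁ K<k with n , refl ← ℕ.m≤n⇒∃[o]m+o≡n K<k = begin
      x ^ (suc K + n) ⊗ T ((suc K + n) ⊖ suc K)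
        ≈⟨ *-cong (^-homo-* x (suc K) n) (reflexive (cong T ([m+n]⊖m (suc K) n))) ⟩
      x ⊗ x ^ K ⊗ x ^ n ⊗ T (+ n)
        ≈⟨ *-congʳ (*-congʳ (*-congʳ (sym a⊗b))) ⟩
      a ⊗ b ⊗ x ^ K ⊗ x ^ n ⊗ T (+ n)
        ≈⟨ solve 5 (λ a b p r t → a :* b :* p :* r :* t := b :* p :* (a :* r :* t))
             ≈-refl a b (x ^ K) (x ^ n) (T (+ n)) ⟩
      b ⊗ x ^ K ⊗ (a ⊗ x ^ n ⊗ T (+ n))
        ≈⟨ *-congˡ (T-suc n) ⟨
      b ⊗ x ^ K ⊗ T (+ suc n)
        ≡⟨ cong (λ i → b ⊗ x ^ K ⊗ T i) (≡.trans (cong (_⊖ K) (≡.sym (ℕ.+-suc K n))) ([m+n]⊖m K (suc n))) ⟨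
      b ⊗ x ^ K ⊗ T ((suc K + n) ⊖ K)
        ∎

    factor : ℕ → Carrier
    factor j = (1# ⊕ a ⊗ x ^ j) ⊗ (1# ⊕ b ⊗ x ^ j)

    -- The finite form of the triple product. Passing from K to K + 1 descends two rows: the first
    -- Pascal rule with `T-down` splits off 1 + b x^K, and the mirrored rule with `T-up` splits off
    -- 1 + a x^K.
    finite-jacobi : ∀ K → ∑ (suc (K ℕ.* 2)) (λ k → binomial (K ℕ.* 2) k ⊗ T (k ⊖ K)) ≈ ∏ K factor
    finite-jacobi zero = trans (+-identityʳ _) (trans (*-identityˡ _) T₀)
    finite-jacobi (suc K) = begin
      ∑ (3 + K ℕ.* 2) (λ k → binomial (2 + K ℕ.* 2) k ⊗ T (k ⊖ suc K))
        ≈⟨ ∑-pascal₁ (1 + K ℕ.* 2) (λ k → T (k ⊖ suc K)) ⟩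
      ∑ (2 + K ℕ.* 2) (λ k → B₁ k ⊗ (x ^ k ⊗ T (k ⊖ suc K) ⊕ 1# ⊗ T (suc k ⊖ suc K)))
        ≈⟨ ∑-cong (2 + K ℕ.* 2) (λ k _ → *-congˡ {x = B₁ k} (+-cong (T-down K k)
             (*-congˡ {x = 1#} (reflexive (cong T (ℤ.[1+m]⊖[1+n]≡m⊖n k K)))))) ⟩
      ∑ (2 + K ℕ.* 2) (λ k → B₁ k ⊗ (b ⊗ x ^ K ⊗ T (k ⊖ K) ⊕ 1# ⊗ T (k ⊖ K)))
        ≈⟨ ∑-cong (2 + K ℕ.* 2) (λ k _ → solve 4 (λ B b p t → B :* (b :* p :* t :+ con 1 :* t) :=
             (con 1 :+ b :* p) :* (B :* t)) ≈-refl (B₁ k) b (x ^ K) (T (k ⊖ K))) ⟩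
      ∑ (2 + K ℕ.* 2) (λ k → (1# ⊕ b ⊗ x ^ K) ⊗ (B₁ k ⊗ T (k ⊖ K)))
        ≈⟨ ∑-distribˡ (2 + K ℕ.* 2) (1# ⊕ b ⊗ x ^ K) (λ k → B₁ k ⊗ T (k ⊖ K)) ⟨
      (1# ⊕ b ⊗ x ^ K) ⊗ ∑ (2 + K ℕ.* 2) (λ k → B₁ k ⊗ T (k ⊖ K))
        ≈⟨ *-congˡ (∑-pascal₂ (K ℕ.* 2) (λ k → T (k ⊖ K))) ⟩
      (1# ⊕ b ⊗ x ^ K) ⊗ ∑ (1 + K ℕ.* 2) (λ k → B₀ k ⊗ (1# ⊗ T (k ⊖ K) ⊕ x ^ (K ℕ.* 2 ∸ k) ⊗ T (suc k ⊖ K)))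
        ≈⟨ *-congˡ (∑-cong (1 + K ℕ.* 2) λ { k (s≤s k≤2K) → trans (*-congˡ (+-congˡ (T-up K k k≤2K)))
             (solve 4 (λ B a p t → B :* (con 1 :* t :+ a :* p :* t) := (con 1 :+ a :* p) :* (B :* t))
               ≈-refl (B₀ k) a (x ^ K) (T (k ⊖ K))) }) ⟩
      (1# ⊕ b ⊗ x ^ K) ⊗ ∑ (1 + K ℕ.* 2) (λ k → (1# ⊕ a ⊗ x ^ K) ⊗ (B₀ k ⊗ T (k ⊖ K)))
        ≈⟨ *-congˡ (∑-distribˡ (1 + K ℕ.* 2) (1# ⊕ a ⊗ x ^ K) (λ k → B₀ k ⊗ T (k ⊖ K))) ⟨
      (1# ⊕ b ⊗ x ^ K) ⊗ ((1# ⊕ a ⊗ x ^ K) ⊗ ∑ (1 + K ℕ.* 2) (λ k → B₀ k ⊗ T (k ⊖ K)))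
        ≈⟨ *-congˡ (*-congˡ (finite-jacobi K)) ⟩
      (1# ⊕ b ⊗ x ^ K) ⊗ ((1# ⊕ a ⊗ x ^ K) ⊗ ∏ K factor)
        ≈⟨ solve 3 (λ u v P → v :* (u :* P) := P :* (u :* v)) ≈-refl (1# ⊕ a ⊗ x ^ K) (1# ⊕ b ⊗ x ^ K) (∏ K factor) ⟩
      ∏ K factor ⊗ factor K
        ≈⟨ ∏-suc K factor ⟨
      ∏ (suc K) factor
        ∎
      where
      B₀ B₁ : ℕ → Carrier
      B₀ = binomial (K ℕ.* 2)
      B₁ = binomial (1 + K ℕ.* 2)

    -- Multiplying the finite form by the Pochhammer product turns each binomial that is at least N
    -- away from both ends of its row into 1. For the remaining k the index k - K has absolute value
    -- at least N, so T vanishes there.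
    jacobi : ∀ {N K} → x ^ N ≈ 0# → N ℕ.* 2 ≤ K → (∀ i → N ≤ ∣ i ∣ → T i ≈ 0#) →
             pochhammer K ⊗ ∏ K factor ≈ ∑ (suc (K ℕ.* 2)) (λ k → T (k ⊖ K))
    jacobi {N} {K} xᴺ≈0 2N≤K T≈0 = begin
      pochhammer K ⊗ ∏ K factor
        ≈⟨ *-congˡ (finite-jacobi K) ⟨
      pochhammer K ⊗ ∑ (suc (K ℕ.* 2)) (λ k → binomial (K ℕ.* 2) k ⊗ T (k ⊖ K))
        ≈⟨ ∑-distribˡ (suc (K ℕ.* 2)) (pochhammer K) (λ k → binomial (K ℕ.* 2) k ⊗ T (k ⊖ K)) ⟩
      ∑ (suc (K ℕ.* 2)) (λ k → pochhammer K ⊗ (binomial (K ℕ.* 2) k ⊗ T (k ⊖ K)))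
        ≈⟨ ∑-cong (suc (K ℕ.* 2)) (λ { k (s≤s k≤2K) → termwise k k≤2K }) ⟩
      ∑ (suc (K ℕ.* 2)) (λ k → T (k ⊖ K))
        ∎
      where
      N≤K : N ≤ K
      N≤K = ℕ.≤-trans (ℕ.m≤m*n N 2) 2N≤K
      vanishing : ∀ k → T (k ⊖ K) ≈ 0# → pochhammer K ⊗ (binomial (K ℕ.* 2) k ⊗ T (k ⊖ K)) ≈ T (k ⊖ K)
      vanishing k T≈0 = trans (trans (*-congˡ (trans (*-congˡ T≈0) (zeroʳ _))) (zeroʳ _)) (sym T≈0)
      termwise : ∀ k → k ≤ K ℕ.* 2 → pochhammer K ⊗ (binomial (K ℕ.* 2) k ⊗ T (k ⊖ K)) ≈ T (k ⊖ K)
      termwise k k≤2K with N ≤? k | N ≤? K ℕ.* 2 ∸ k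
      ... | yes N≤k | yes N≤j = begin
        pochhammer K ⊗ (binomial (K ℕ.* 2) k ⊗ T (k ⊖ K))
          ≈⟨ *-assoc _ _ _ ⟨
        pochhammer K ⊗ binomial (K ℕ.* 2) k ⊗ T (k ⊖ K)
          ≡⟨ cong (λ m → pochhammer K ⊗ binomial m k ⊗ T (k ⊖ K)) (ℕ.m+[n∸m]≡n k≤2K) ⟨
        pochhammer K ⊗ binomial (k + (K ℕ.* 2 ∸ k)) k ⊗ T (k ⊖ K)
          ≈⟨ *-congʳ (binomial-pochhammer-limit xᴺ≈0 N≤k N≤j N≤K) ⟩
        1# ⊗ T (k ⊖ K)
          ≈⟨ *-identityˡ _ ⟩
        T (k ⊖ K)
          ∎
      ... | no N≰k | _ = vanishing k (T≈0 _ (∣⊖∣-≥ (inj₁ k+N≤K)))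
        where
        k+N≤K : k + N ≤ K
        k+N≤K = ℕ.≤-trans (ℕ.+-monoˡ-≤ N (ℕ.≰⇒≥ N≰k)) (subst (_≤ K) (n*2≡n+n N) 2N≤K)
      ... | yes _ | no N≰j = vanishing k (T≈0 _ (∣⊖∣-≥ (inj₂ K+N≤k)))
        where
        K+N≤k : K + N ≤ k
        K+N≤k = deficit-≤ 2N≤K k≤2K (ℕ.≰⇒≥ N≰j)

-- Bilateral sums, q-products and theta series when powers of q are cut off at N.

module TruncatedTheta (R : CommutativeRing 0ℓ 0ℓ) (q : CommutativeRing.Carrier R) (N : ℕ) where
  open CommutativeRing R renaming (_+_ to _⊕_; _*_ to _⊗_; refl to ≈-refl; -_ to ⊝_) hiding (_-_; zero)
  open JacobiTripleProduct R
  open SemiringSolver commutativeSemiring using (solve; _:+_; _:*_; _:=_; con)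
  open SetoidReasoning setoid

  Vanishing : (ℤ → Carrier) → Set
  Vanishing f = ∀ i → N ≤ ∣ i ∣ → f i ≈ 0#

  -- For `Vanishing` f this is the full bilateral sum, since the support lies in ∣i∣ < N.
  ∑ℤ : (ℤ → Carrier) → Carrier
  ∑ℤ f = ∑ (N ℕ.* 2) (λ k → f (k ⊖ N))

  -- Any window containing the support gives the same sum; this takes the place of convergence.
  ∑-window : ∀ {f} → Vanishing f → ∀ {a m} → N ≤ a → a + N ≤ m → ∑ m (λ k → f (k ⊖ a)) ≈ ∑ℤ f
  ∑-window {f} f≈0 N≤a a+N≤m
    with p , refl ← ℕ.m≤n⇒∃[o]m+o≡n N≤a
    with r , refl ← ℕ.m≤n⇒∃[o]m+o≡n a+N≤m = begin
    ∑ (N + p + N + r) (λ k → f (k ⊖ (N + p)))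
      ≡⟨ cong (λ m → ∑ m (λ k → f (k ⊖ (N + p)))) (regroup N p r) ⟩
    ∑ (p + (N ℕ.* 2 + r)) (λ k → f (k ⊖ (N + p)))
      ≈⟨ ∑-+ p (N ℕ.* 2 + r) (λ k → f (k ⊖ (N + p))) ⟩
    ∑ p (λ k → f (k ⊖ (N + p))) ⊕ ∑ (N ℕ.* 2 + r) (λ k → f ((p + k) ⊖ (N + p)))
      ≈⟨ +-cong (∑-0 p λ k k<p → f≈0 _ (∣⊖∣-≥ (inj₁ (below k<p))))
                (∑-cong (N ℕ.* 2 + r) λ k _ → reflexive (cong f (recentre k))) ⟩
    0# ⊕ ∑ (N ℕ.* 2 + r) (λ k → f (k ⊖ N))
      ≈⟨ +-identityˡ _ ⟩
    ∑ (N ℕ.* 2 + r) (λ k → f (k ⊖ N))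
      ≈⟨ ∑-cutoff (ℕ.m≤m+n (N ℕ.* 2) r) (λ k 2N≤k → f≈0 _ (∣⊖∣-≥ {k} {N} (inj₂ (subst (_≤ k) (n*2≡n+n N) 2N≤k)))) ⟩
    ∑ℤ f
      ∎
    where
    regroup : ∀ N p r → N + p + N + r ≡ p + (N ℕ.* 2 + r)
    regroup = ℕSolver.solve-∀
    below : ∀ {k} → k < p → k + N ≤ N + p
    below {k} k<p = subst (_≤ N + p) (ℕ.+-comm N k) (ℕ.+-monoʳ-≤ N (ℕ.<⇒≤ k<p))
    recentre : ∀ k → (p + k) ⊖ (N + p) ≡ k ⊖ N
    recentre k = ≡.trans (cong ((p + k) ⊖_) (ℕ.+-comm N p)) (ℤ.+-cancelˡ-⊖ p k N)

  -- Translation invariance of a bilateral sum: the half-width has to exceed N by the size of the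
  -- shift, so that the moved window still covers the support.
  ∑-shift : ∀ {f} → Vanishing f → ∀ d {K} → N + ∣ d ∣ ≤ K →
            ∑ (K ℕ.* 2) (λ k → f ((k ⊖ K) ℤ.+ d)) ≈ ∑ℤ f
  ∑-shift {f} f≈0 (+ p) {K} N+p≤K
    with r , refl ← ℕ.m≤n⇒∃[o]m+o≡n N+p≤K = begin
    ∑ (K ℕ.* 2) (λ k → f ((k ⊖ (N + p + r)) ℤ.+ + p))
      ≈⟨ ∑-cong (K ℕ.* 2) (λ k _ → reflexive (cong f (index k))) ⟩
    ∑ (K ℕ.* 2) (λ k → f (k ⊖ (N + r)))
      ≈⟨ ∑-window f≈0 (ℕ.m≤m+n N r) (subst (N + r + N ≤_) (≡.sym (double N p r)) (ℕ.m≤m+n _ _)) ⟩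
    ∑ℤ f
      ∎
    where
    double : ∀ N p r → (N + p + r) ℕ.* 2 ≡ (N + r + N) + (p + p + r)
    double = ℕSolver.solve-∀
    regroup : ∀ N p r → N + p + r ≡ p + (N + r)
    regroup = ℕSolver.solve-∀
    index : ∀ k → (k ⊖ (N + p + r)) ℤ.+ + p ≡ k ⊖ (N + r)
    index k = ≡.trans (ℤ.distribˡ-⊖-+-pos p k (N + p + r))
      (≡.trans (cong₂ _⊖_ (ℕ.+-comm k p) (regroup N p r)) (ℤ.+-cancelˡ-⊖ p k (N + r)))
  ∑-shift {f} f≈0 -[1+ p ] {K} N+p≤K = begin
    ∑ (K ℕ.* 2) (λ k → f ((k ⊖ K) ℤ.+ -[1+ p ]))
      ≈⟨ ∑-cong (K ℕ.* 2) (λ k _ → reflexive (cong f (ℤ.distribˡ-⊖-+-neg p k K))) ⟩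
    ∑ (K ℕ.* 2) (λ k → f (k ⊖ (suc K + p)))
      ≈⟨ ∑-window f≈0 (ℕ.m≤n⇒m≤n+o p (ℕ.m≤n⇒m≤1+n (ℕ.m+n≤o⇒m≤o N N+p≤K))) bound ⟩
    ∑ℤ f
      ∎
    where
    regroup : ∀ K p N → suc K + p + N ≡ K + (N + suc p)
    regroup = ℕSolver.solve-∀
    bound : suc K + p + N ≤ K ℕ.* 2
    bound = subst₂ _≤_ (≡.sym (regroup K p N)) (≡.sym (n*2≡n+n K)) (ℕ.+-monoʳ-≤ K N+p≤K)

  private
    -- `K₁` leaves room for a shift by e with ∣e∣ ≤ 1. `K₂` leaves room for a shift by any index (i
    -- ⊖ K₁) + e of the outer sum, crudely bounded by K₁ * 2 + 1.
    K₁ K₂ : ℕ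
    K₁ = suc N
    K₂ = N + (K₁ ℕ.* 2 + 1)

    K₁≤2K₁ : K₁ ≤ K₁ ℕ.* 2
    K₁≤2K₁ = ℕ.m≤m*n K₁ 2

    index≤ : ∀ {i} e → i < K₁ ℕ.* 2 → ∣ e ∣ ≤ 1 → N + ∣ (i ⊖ K₁) ℤ.+ e ∣ ≤ K₂
    index≤ {i} e i<2K₁ e≤1 = ℕ.+-monoʳ-≤ N (ℕ.≤-trans (ℤ.∣i+j∣≤∣i∣+∣j∣ (i ⊖ K₁) e)
      (ℕ.+-mono-≤ (ℕ.≤-trans (ℤ.∣m⊝n∣≤m⊔n i K₁) (ℕ.⊔-lub (ℕ.<⇒≤ i<2K₁) K₁≤2K₁)) e≤1))

  -- The square is summed over n and d = m - n. Writing n = i′ + e with i′ = i ⊖ K₁, the other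
  -- variable is s = m + n - e = 2i′ + e + d, so e selects the parity of s - d.
  row-sums : ∀ {φ} (f g : ℤ → Carrier) c e → Vanishing φ → ∣ e ∣ ≤ 1 →
             (∀ m n → c ⊗ (φ m ⊗ φ n) ≈ f (m ℤ.+ n ℤ.- e) ⊗ g (m ℤ.- n)) →
             c ⊗ (∑ℤ φ ⊗ ∑ℤ φ) ≈
             ∑ (K₁ ℕ.* 2) (λ i → ∑ (K₂ ℕ.* 2) (λ j → g (j ⊖ K₂) ⊗ f (((i ⊖ K₁) ℤ.+ (i ⊖ K₁) ℤ.+ e) ℤ.+ (j ⊖ K₂))))
  row-sums {φ} f g c e φ≈0 ∣e∣≤1 φφ≈fg = begin
    c ⊗ (∑ℤ φ ⊗ ∑ℤ φ)
      ≈⟨ solve 2 (λ c z → c :* (z :* z) := (c :* z) :* z) ≈-refl c (∑ℤ φ) ⟩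
    (c ⊗ ∑ℤ φ) ⊗ ∑ℤ φ
      ≈⟨ *-congˡ (∑-shift φ≈0 e N+∣e∣≤K₁) ⟨
    (c ⊗ ∑ℤ φ) ⊗ ∑ (K₁ ℕ.* 2) (λ i → φ ((i ⊖ K₁) ℤ.+ e))
      ≈⟨ ∑-distribˡ (K₁ ℕ.* 2) (c ⊗ ∑ℤ φ) (λ i → φ ((i ⊖ K₁) ℤ.+ e)) ⟩
    ∑ (K₁ ℕ.* 2) (λ i → (c ⊗ ∑ℤ φ) ⊗ φ ((i ⊖ K₁) ℤ.+ e))
      ≈⟨ ∑-cong (K₁ ℕ.* 2) (λ i i<2K₁ → row i i<2K₁) ⟩
    ∑ (K₁ ℕ.* 2) (λ i → ∑ (K₂ ℕ.* 2) (λ j → g (j ⊖ K₂) ⊗ f (((i ⊖ K₁) ℤ.+ (i ⊖ K₁) ℤ.+ e) ℤ.+ (j ⊖ K₂))))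
      ∎
    where
    N+∣e∣≤K₁ : N + ∣ e ∣ ≤ K₁
    N+∣e∣≤K₁ = subst (N + ∣ e ∣ ≤_) (ℕ.+-comm N 1) (ℕ.+-monoʳ-≤ N ∣e∣≤1)
    sum-index : ∀ j n e → (j ℤ.+ (n ℤ.+ e)) ℤ.+ (n ℤ.+ e) ℤ.- e ≡ (n ℤ.+ n ℤ.+ e) ℤ.+ j
    sum-index = ℤSolver.solve-∀
    difference-index : ∀ j n → (j ℤ.+ n) ℤ.- n ≡ j
    difference-index = ℤSolver.solve-∀
    row : ∀ i → i < K₁ ℕ.* 2 → (c ⊗ ∑ℤ φ) ⊗ φ ((i ⊖ K₁) ℤ.+ e) ≈
          ∑ (K₂ ℕ.* 2) (λ j → g (j ⊖ K₂) ⊗ f (((i ⊖ K₁) ℤ.+ (i ⊖ K₁) ℤ.+ e) ℤ.+ (j ⊖ K₂)))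
    row i i<2K₁ = begin
      (c ⊗ ∑ℤ φ) ⊗ φ n
        ≈⟨ solve 3 (λ c z p → (c :* z) :* p := (c :* p) :* z) ≈-refl c (∑ℤ φ) (φ n) ⟩
      (c ⊗ φ n) ⊗ ∑ℤ φ
        ≈⟨ *-congˡ (∑-shift φ≈0 n (index≤ e i<2K₁ ∣e∣≤1)) ⟨
      (c ⊗ φ n) ⊗ ∑ (K₂ ℕ.* 2) (λ j → φ ((j ⊖ K₂) ℤ.+ n))
        ≈⟨ ∑-distribˡ (K₂ ℕ.* 2) (c ⊗ φ n) (λ j → φ ((j ⊖ K₂) ℤ.+ n)) ⟩
      ∑ (K₂ ℕ.* 2) (λ j → (c ⊗ φ n) ⊗ φ ((j ⊖ K₂) ℤ.+ n))
        ≈⟨ ∑-cong (K₂ ℕ.* 2) (λ j _ → term j) ⟩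
      ∑ (K₂ ℕ.* 2) (λ j → g (j ⊖ K₂) ⊗ f (((i ⊖ K₁) ℤ.+ (i ⊖ K₁) ℤ.+ e) ℤ.+ (j ⊖ K₂)))
        ∎
      where
      n : ℤ
      n = (i ⊖ K₁) ℤ.+ e
      term : ∀ j → (c ⊗ φ n) ⊗ φ ((j ⊖ K₂) ℤ.+ n) ≈
                   g (j ⊖ K₂) ⊗ f (((i ⊖ K₁) ℤ.+ (i ⊖ K₁) ℤ.+ e) ℤ.+ (j ⊖ K₂))
      term j = begin
        (c ⊗ φ n) ⊗ φ ((j ⊖ K₂) ℤ.+ n)
          ≈⟨ solve 3 (λ c p p′ → (c :* p) :* p′ := c :* (p′ :* p)) ≈-refl c (φ n) (φ ((j ⊖ K₂) ℤ.+ n)) ⟩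
        c ⊗ (φ ((j ⊖ K₂) ℤ.+ n) ⊗ φ n)
          ≈⟨ φφ≈fg ((j ⊖ K₂) ℤ.+ n) n ⟩
        f (((j ⊖ K₂) ℤ.+ n) ℤ.+ n ℤ.- e) ⊗ g (((j ⊖ K₂) ℤ.+ n) ℤ.- n)
          ≡⟨ cong₂ (λ s d → f s ⊗ g d) (sum-index (j ⊖ K₂) (i ⊖ K₁) e) (difference-index (j ⊖ K₂) n) ⟩
        f (((i ⊖ K₁) ℤ.+ (i ⊖ K₁) ℤ.+ e) ℤ.+ (j ⊖ K₂)) ⊗ g (j ⊖ K₂)
          ≈⟨ *-comm _ _ ⟩
        g (j ⊖ K₂) ⊗ f (((i ⊖ K₁) ℤ.+ (i ⊖ K₁) ℤ.+ e) ℤ.+ (j ⊖ K₂))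
          ∎

  -- (m + n , m - n) runs over the pairs (s , d) with s ≡ d (mod 2), and
  -- (m + n - 1 , m - n) over those with s ≢ d (mod 2).
  ∑²-⊕-∑² : ∀ {φ ψ f g c} → Vanishing φ → Vanishing ψ → Vanishing f → Vanishing g →
    (∀ m n → φ m ⊗ φ n ≈ f (m ℤ.+ n ℤ.- + 0) ⊗ g (m ℤ.- n)) →
    (∀ m n → c ⊗ (ψ m ⊗ ψ n) ≈ f (m ℤ.+ n ℤ.- + 1) ⊗ g (m ℤ.- n)) →
    ∑ℤ φ ⊗ ∑ℤ φ ⊕ c ⊗ (∑ℤ ψ ⊗ ∑ℤ ψ) ≈ ∑ℤ f ⊗ ∑ℤ g
  ∑²-⊕-∑² {φ} {ψ} {f} {g} {c} φ≈0 ψ≈0 f≈0 g≈0 φφ≈fg ψψ≈fg = begin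
    ∑ℤ φ ⊗ ∑ℤ φ ⊕ c ⊗ (∑ℤ ψ ⊗ ∑ℤ ψ)
      ≈⟨ +-cong (trans (sym (*-identityˡ _))
                  (row-sums f g 1# (+ 0) φ≈0 z≤n (λ m n → trans (*-identityˡ _) (φφ≈fg m n))))
                (row-sums f g c (+ 1) ψ≈0 (s≤s z≤n) ψψ≈fg) ⟩
    ∑ (K₁ ℕ.* 2) (λ i → ∑ (K₂ ℕ.* 2) (λ j → h (+ 0) i j)) ⊕ ∑ (K₁ ℕ.* 2) (λ i → ∑ (K₂ ℕ.* 2) (λ j → h (+ 1) i j))
      -- With d outermost, the even and the odd family can be joined for each fixed d.
      ≈⟨ +-cong (∑-swap (K₁ ℕ.* 2) (K₂ ℕ.* 2) (h (+ 0))) (∑-swap (K₁ ℕ.* 2) (K₂ ℕ.* 2) (h (+ 1))) ⟩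
    ∑ (K₂ ℕ.* 2) (λ j → ∑ (K₁ ℕ.* 2) (λ i → h (+ 0) i j)) ⊕ ∑ (K₂ ℕ.* 2) (λ j → ∑ (K₁ ℕ.* 2) (λ i → h (+ 1) i j))
      ≈⟨ ∑-⊕ (K₂ ℕ.* 2) _ _ ⟨
    ∑ (K₂ ℕ.* 2) (λ j → ∑ (K₁ ℕ.* 2) (λ i → h (+ 0) i j) ⊕ ∑ (K₁ ℕ.* 2) (λ i → h (+ 1) i j))
      ≈⟨ ∑-cong (K₂ ℕ.* 2) (λ j _ → column j) ⟩
    ∑ (K₂ ℕ.* 2) (λ j → ∑ℤ f ⊗ g (j ⊖ K₂))
      ≈⟨ ∑-distribˡ (K₂ ℕ.* 2) (∑ℤ f) (λ j → g (j ⊖ K₂)) ⟨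
    ∑ℤ f ⊗ ∑ (K₂ ℕ.* 2) (λ j → g (j ⊖ K₂))
      ≈⟨ *-congˡ (∑-window g≈0 (ℕ.m≤m+n N _) (subst (K₂ + N ≤_) (≡.sym (n*2≡n+n K₂)) (ℕ.+-monoʳ-≤ K₂ (ℕ.m≤m+n N _)))) ⟩
    ∑ℤ f ⊗ ∑ℤ g
      ∎
    where
    h : ℤ → ℕ → ℕ → Carrier
    h e i j = g (j ⊖ K₂) ⊗ f (((i ⊖ K₁) ℤ.+ (i ⊖ K₁) ℤ.+ e) ℤ.+ (j ⊖ K₂))

    even-index : ∀ i → i ℕ.* 2 ⊖ K₁ ℕ.* 2 ≡ (i ⊖ K₁) ℤ.+ (i ⊖ K₁) ℤ.+ + 0
    even-index i = ≡.trans (m*2⊖n*2 i K₁) (≡.sym (ℤ.+-identityʳ _))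

    odd-index : ∀ i → suc (i ℕ.* 2) ⊖ K₁ ℕ.* 2 ≡ (i ⊖ K₁) ℤ.+ (i ⊖ K₁) ℤ.+ + 1
    odd-index i = ≡.trans (cong (_⊖ K₁ ℕ.* 2) (ℕ.+-comm 1 (i ℕ.* 2)))
      (≡.trans (≡.sym (ℤ.distribˡ-⊖-+-pos 1 (i ℕ.* 2) (K₁ ℕ.* 2))) (cong (ℤ._+ + 1) (m*2⊖n*2 i K₁)))

    column : ∀ j → ∑ (K₁ ℕ.* 2) (λ i → h (+ 0) i j) ⊕ ∑ (K₁ ℕ.* 2) (λ i → h (+ 1) i j) ≈ ∑ℤ f ⊗ g (j ⊖ K₂)
    column j = begin
      ∑ (K₁ ℕ.* 2) (λ i → g d ⊗ F (+ 0) i) ⊕ ∑ (K₁ ℕ.* 2) (λ i → g d ⊗ F (+ 1) i)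
        ≈⟨ +-cong (∑-distribˡ (K₁ ℕ.* 2) (g d) (F (+ 0))) (∑-distribˡ (K₁ ℕ.* 2) (g d) (F (+ 1))) ⟨
      g d ⊗ ∑ (K₁ ℕ.* 2) (F (+ 0)) ⊕ g d ⊗ ∑ (K₁ ℕ.* 2) (F (+ 1))
        ≈⟨ trans (*-congˡ (∑-⊕ (K₁ ℕ.* 2) (F (+ 0)) (F (+ 1)))) (distribˡ _ _ _) ⟨
      g d ⊗ ∑ (K₁ ℕ.* 2) (λ i → F (+ 0) i ⊕ F (+ 1) i)
        ≈⟨ *-congˡ (∑-cong (K₁ ℕ.* 2) λ i _ → reflexive
             (cong₂ (λ s t → f (s ℤ.+ d) ⊕ f (t ℤ.+ d)) (≡.sym (even-index i)) (≡.sym (odd-index i)))) ⟩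
      g d ⊗ ∑ (K₁ ℕ.* 2) (λ i → f ((i ℕ.* 2 ⊖ K₁ ℕ.* 2) ℤ.+ d) ⊕ f ((suc (i ℕ.* 2) ⊖ K₁ ℕ.* 2) ℤ.+ d))
        ≈⟨ *-congˡ (∑-parity (K₁ ℕ.* 2) (λ s → f ((s ⊖ K₁ ℕ.* 2) ℤ.+ d))) ⟨
      g d ⊗ ∑ (K₁ ℕ.* 2 ℕ.* 2) (λ s → f ((s ⊖ K₁ ℕ.* 2) ℤ.+ d))
        ≈⟨ collapse ⟩
      ∑ℤ f ⊗ g d
        ∎
      where
      d : ℤ
      d = j ⊖ K₂
      F : ℤ → ℕ → Carrier
      F e i = f (((i ⊖ K₁) ℤ.+ (i ⊖ K₁) ℤ.+ e) ℤ.+ d)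
      collapse : g d ⊗ ∑ (K₁ ℕ.* 2 ℕ.* 2) (λ s → f ((s ⊖ K₁ ℕ.* 2) ℤ.+ d)) ≈ ∑ℤ f ⊗ g d
      -- The joined window has half-width K₁ * 2, enough for a shift by d when ∣d∣ < N. For larger
      -- ∣d∣ the factor g d makes both sides vanish.
      collapse with N ≤? ∣ d ∣
      ... | yes N≤d = trans (trans (*-congʳ (g≈0 d N≤d)) (zeroˡ _)) (sym (trans (*-congˡ (g≈0 d N≤d)) (zeroʳ _)))
      ... | no  N≰d = trans (*-comm _ _) (*-congʳ (∑-shift f≈0 d
                        (subst (N + ∣ d ∣ ≤_) (≡.sym (n*2≡n+n K₁)) (ℕ.+-mono-≤ (ℕ.n≤1+n N) (ℕ.m≤n⇒m≤1+n (ℕ.≰⇒≥ N≰d))))))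

  -- The first K factors of (-σ q^r; q^w)_∞. Thus σ = `-1#` gives the usual product, and σ = `1#`
  -- the one with plus signs.
  Φ : Carrier → ℕ → ℕ → ℕ → Carrier
  Φ σ r w K = ∏ K (λ j → 1# ⊕ σ ⊗ q ^ (r + j ℕ.* w))

  -- The hypothesis says G′ = G / (1 - y) without division. Each coloured part of size r contributes
  -- one such step with y = q^r.
  geometric : ∀ {G G′ y P} → G′ ≈ G ⊕ y ⊗ G′ → G′ ⊗ ((1# ⊕ -1# ⊗ y) ⊗ P) ≈ G ⊗ P
  geometric {G} {G′} {y} {P} G′≈ = begin
    G′ ⊗ ((1# ⊕ -1# ⊗ y) ⊗ P)
      ≈⟨ solve 4 (λ g m y P → g :* ((con 1 :+ m :* y) :* P) := (g :+ m :* (y :* g)) :* P) ≈-refl G′ -1# y P ⟩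
    (G′ ⊕ -1# ⊗ (y ⊗ G′)) ⊗ P
      ≈⟨ *-congʳ (+-congʳ G′≈) ⟩
    (G ⊕ y ⊗ G′ ⊕ -1# ⊗ (y ⊗ G′)) ⊗ P
      ≈⟨ *-congʳ (solve 3 (λ g m z → g :+ z :+ m :* z := g :+ (con 1 :+ m) :* z) ≈-refl G -1# (y ⊗ G′)) ⟩
    (G ⊕ (1# ⊕ -1#) ⊗ (y ⊗ G′)) ⊗ P
      ≈⟨ *-congʳ (trans (+-congˡ (trans (*-congʳ 1⊕-1) (zeroˡ _))) (+-identityʳ G)) ⟩
    G ⊗ P
      ∎

  inverse-unique : ∀ {x y P Q} → x ⊗ P ≈ 1# → y ⊗ Q ≈ 1# → P ≈ Q → x ≈ y
  inverse-unique {x} {y} {P} {Q} xP≈1 yQ≈1 P≈Q = begin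
    x           ≈⟨ trans (*-congˡ yQ≈1) (*-identityʳ x) ⟨
    x ⊗ (y ⊗ Q) ≈⟨ *-congˡ (trans (*-comm y Q) (*-congʳ (sym P≈Q))) ⟩
    x ⊗ (P ⊗ y) ≈⟨ *-assoc x P y ⟨
    x ⊗ P ⊗ y   ≈⟨ trans (*-congʳ xP≈1) (*-identityˡ y) ⟩
    y           ∎

  ∏[1-q^_] : List ℕ → Carrier
  ∏[1-q^ rs ] = foldr (λ r p → (1# ⊕ -1# ⊗ q ^ r) ⊗ p) 1# rs

  ∏[1-q^]-++ : ∀ rs ss → ∏[1-q^ rs ++ ss ] ≈ ∏[1-q^ rs ] ⊗ ∏[1-q^ ss ]
  ∏[1-q^]-++ []       ss = sym (*-identityˡ _)
  ∏[1-q^]-++ (r ∷ rs) ss = trans (*-congˡ (∏[1-q^]-++ rs ss)) (sym (*-assoc _ _ _))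

  ∏[1-q^]-concatMap : ∀ (f : ℕ → List ℕ) g n →
                      ∏[1-q^ concatMap f (applyUpTo g n) ] ≈ ∏ n (λ k → ∏[1-q^ f (g k) ])
  ∏[1-q^]-concatMap f g zero    = ≈-refl
  ∏[1-q^]-concatMap f g (suc n) = trans (∏[1-q^]-++ (f (g 0)) _) (*-congˡ (∏[1-q^]-concatMap f (g ∘ suc) n))

  ∏[1-q^]-translates : ∀ w K rs → ∏ K (λ j → ∏[1-q^ map (λ r → r + j ℕ.* w) rs ]) ≈
                       foldr (λ r p → Φ -1# r w K ⊗ p) 1# rs
  ∏[1-q^]-translates w K []       = ∏-1 K (λ _ _ → ≈-refl)
  ∏[1-q^]-translates w K (r ∷ rs) = trans (∏-⊗ K _ _) (*-congˡ (∏[1-q^]-translates w K rs))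

  -- Cut the sizes into K blocks of length w. By periodicity each block is a translate of the first,
  -- so collecting the factors of one residue over all blocks gives a `Φ`.
  ∏[1-q^]-periodic : ∀ {c} w K → (∀ j k → c (j ℕ.* w + k) ≡ c k) →
                     ∏[1-q^ sizes c (K ℕ.* w) ] ≈ foldr (λ r p → Φ -1# r w K ⊗ p) 1# (sizes c w)
  ∏[1-q^]-periodic {c} w K periodic = begin
    ∏[1-q^ sizes c (K ℕ.* w) ]
      ≈⟨ ∏[1-q^]-concatMap (copies c) id (K ℕ.* w) ⟩
    ∏ (K ℕ.* w) (λ k → ∏[1-q^ copies c k ])
      ≈⟨ ∏-blocks K w (λ k → ∏[1-q^ copies c k ]) ⟩
    ∏ K (λ j → ∏ w (λ s → ∏[1-q^ copies c (j ℕ.* w + s) ]))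
      ≈⟨ ∏-cong K (λ j _ → ∏-cong w (λ s _ → reflexive (cong ∏[1-q^_] (translate j s)))) ⟩
    ∏ K (λ j → ∏ w (λ s → ∏[1-q^ map (λ r → r + j ℕ.* w) (copies c s) ]))
      ≈⟨ ∏-cong K (λ j _ → ∏[1-q^]-concatMap (λ s → map (λ r → r + j ℕ.* w) (copies c s)) id w) ⟨
    ∏ K (λ j → ∏[1-q^ concatMap (λ s → map (λ r → r + j ℕ.* w) (copies c s)) (upTo w) ])
      ≈⟨ ∏-cong K (λ j _ → reflexive (cong ∏[1-q^_] (≡.sym (map-concatMap (λ r → r + j ℕ.* w) (copies c) (upTo w))))) ⟩
    ∏ K (λ j → ∏[1-q^ map (λ r → r + j ℕ.* w) (sizes c w) ])
      ≈⟨ ∏[1-q^]-translates w K (sizes c w) ⟩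
    foldr (λ r p → Φ -1# r w K ⊗ p) 1# (sizes c w)
      ∎
    where
    translate : ∀ j s → copies c (j ℕ.* w + s) ≡ map (λ r → r + j ℕ.* w) (copies c s)
    translate j s = ≡.trans (cong₂ replicate colour (cong suc (ℕ.+-comm (j ℕ.* w) s)))
      (≡.sym (map-replicate (λ r → r + j ℕ.* w) (c (suc s)) (suc s)))
      where
      colour : c (suc (j ℕ.* w + s)) ≡ c (suc s)
      colour = ≡.trans (cong c (≡.sym (ℕ.+-suc (j ℕ.* w) s))) (periodic j (suc s))

  Φ-parity : ∀ σ r w K → Φ σ r w (K ℕ.* 2) ≈ Φ σ r (w ℕ.* 2) K ⊗ Φ σ (r + w) (w ℕ.* 2) K
  Φ-parity σ r w K = begin
    Φ σ r w (K ℕ.* 2)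
      ≈⟨ ∏-parity K (λ j → term (r + j ℕ.* w)) ⟩
    ∏ K (λ k → term (r + k ℕ.* 2 ℕ.* w) ⊗ term (r + suc (k ℕ.* 2) ℕ.* w))
      ≈⟨ ∏-cong K (λ k _ → reflexive (cong₂ (λ e o → term e ⊗ term o) (even r w k) (odd r w k))) ⟩
    ∏ K (λ k → term (r + k ℕ.* (w ℕ.* 2)) ⊗ term (r + w + k ℕ.* (w ℕ.* 2)))
      ≈⟨ ∏-⊗ K _ _ ⟩
    Φ σ r (w ℕ.* 2) K ⊗ Φ σ (r + w) (w ℕ.* 2) K
      ∎
    where
    term : ℕ → Carrier
    term e = 1# ⊕ σ ⊗ q ^ e
    even : ∀ r w k → r + k ℕ.* 2 ℕ.* w ≡ r + k ℕ.* (w ℕ.* 2)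
    even = ℕSolver.solve-∀
    odd : ∀ r w k → r + suc (k ℕ.* 2) ℕ.* w ≡ r + w + k ℕ.* (w ℕ.* 2)
    odd = ℕSolver.solve-∀

  -- Needed because the unsigned series Σ q^(19s²+s) has a product with plus signs, while partitions
  -- produce only minus signs.
  Φ-difference-of-squares : ∀ r w K → Φ -1# r w K ⊗ Φ 1# r w K ≈ Φ -1# (r ℕ.* 2) (w ℕ.* 2) K
  Φ-difference-of-squares r w K = trans (sym (∏-⊗ K _ _)) (∏-cong K λ j _ → begin
    (1# ⊕ -1# ⊗ q ^ (r + j ℕ.* w)) ⊗ (1# ⊕ 1# ⊗ q ^ (r + j ℕ.* w))
      ≈⟨ solve 2 (λ m y → (con 1 :+ m :* y) :* (con 1 :+ con 1 :* y) :=
           con 1 :+ m :* (y :* y) :+ (con 1 :+ m) :* y) ≈-refl -1# (q ^ (r + j ℕ.* w)) ⟩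
    (1# ⊕ -1# ⊗ (q ^ (r + j ℕ.* w) ⊗ q ^ (r + j ℕ.* w))) ⊕ (1# ⊕ -1#) ⊗ q ^ (r + j ℕ.* w)
      ≈⟨ trans (+-congˡ (trans (*-congʳ 1⊕-1) (zeroˡ _))) (+-identityʳ _) ⟩
    1# ⊕ -1# ⊗ (q ^ (r + j ℕ.* w) ⊗ q ^ (r + j ℕ.* w))
      ≈⟨ +-congˡ (*-congˡ (^-homo-* q (r + j ℕ.* w) (r + j ℕ.* w))) ⟨
    1# ⊕ -1# ⊗ q ^ ((r + j ℕ.* w) + (r + j ℕ.* w))
      ≡⟨ cong (λ e → 1# ⊕ -1# ⊗ q ^ e) (double r w j) ⟩
    1# ⊕ -1# ⊗ q ^ (r ℕ.* 2 + j ℕ.* (w ℕ.* 2))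
      ∎)
    where
    double : ∀ r w j → (r + j ℕ.* w) + (r + j ℕ.* w) ≡ r ℕ.* 2 + j ℕ.* (w ℕ.* 2)
    double = ℕSolver.solve-∀

  module Signs {σ} (σ⊗σ : σ ⊗ σ ≈ 1#) where

    -- Since σ is its own inverse, the exponent ∣ i ∣ stands for i itself, and σ^(m+n) agrees with
    -- σ^(m-n).
    sign : ℤ → Carrier
    sign i = σ ^ ∣ i ∣

    sign-suc : ∀ i → sign (ℤ.suc i) ≈ σ ⊗ sign i
    sign-suc (+ n)          = ≈-refl
    sign-suc -[1+ zero ]    = trans (sym σ⊗σ) (*-congˡ (sym (*-identityʳ σ)))
    sign-suc -[1+ suc n ]   = trans (sym (*-identityˡ _)) (trans (*-congʳ (sym σ⊗σ)) (*-assoc _ _ _))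

    sign-+ : ∀ k i → sign (+ k ℤ.+ i) ≈ σ ^ k ⊗ sign i
    sign-+ zero    i = trans (reflexive (cong sign (ℤ.+-identityˡ i))) (sym (*-identityˡ _))
    sign-+ (suc k) i = begin
      sign (+ suc k ℤ.+ i)       ≡⟨ cong sign (ℤ.+-assoc (+ 1) (+ k) i) ⟩
      sign (ℤ.suc (+ k ℤ.+ i))   ≈⟨ sign-suc (+ k ℤ.+ i) ⟩
      σ ⊗ sign (+ k ℤ.+ i)       ≈⟨ *-congˡ (sign-+ k i) ⟩
      σ ⊗ (σ ^ k ⊗ sign i)       ≈⟨ *-assoc _ _ _ ⟨
      σ ^ suc k ⊗ sign i         ∎

    σ^²≈1 : ∀ k → σ ^ k ⊗ σ ^ k ≈ 1#
    σ^²≈1 zero    = *-identityˡ 1#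
    σ^²≈1 (suc k) = begin
      (σ ⊗ σ ^ k) ⊗ (σ ⊗ σ ^ k) ≈⟨ solve 2 (λ s p → (s :* p) :* (s :* p) := (s :* s) :* (p :* p)) ≈-refl σ (σ ^ k) ⟩
      (σ ⊗ σ) ⊗ (σ ^ k ⊗ σ ^ k) ≈⟨ *-cong σ⊗σ (σ^²≈1 k) ⟩
      1# ⊗ 1#                   ≈⟨ *-identityˡ 1# ⟩
      1#                        ∎

    sign-⊗ : ∀ m n → sign m ⊗ sign n ≈ sign (m ℤ.- n)
    sign-⊗ m (+ n) = begin
      sign m ⊗ σ ^ n                           ≡⟨ cong (λ i → sign i ⊗ σ ^ n) (cancel m (+ n)) ⟩
      sign (+ n ℤ.+ (m ℤ.- + n)) ⊗ σ ^ n       ≈⟨ *-congʳ (sign-+ n (m ℤ.- + n)) ⟩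
      (σ ^ n ⊗ sign (m ℤ.- + n)) ⊗ σ ^ n       ≈⟨ solve 2 (λ p s → (p :* s) :* p := (p :* p) :* s) ≈-refl (σ ^ n) (sign (m ℤ.- + n)) ⟩
      (σ ^ n ⊗ σ ^ n) ⊗ sign (m ℤ.- + n)       ≈⟨ trans (*-congʳ (σ^²≈1 n)) (*-identityˡ _) ⟩
      sign (m ℤ.- + n)                         ∎
      where
      cancel : ∀ m n → m ≡ n ℤ.+ (m ℤ.- n)
      cancel = ℤSolver.solve-∀
    sign-⊗ m -[1+ n ] = begin
      sign m ⊗ σ ^ suc n      ≈⟨ *-comm _ _ ⟩
      σ ^ suc n ⊗ sign m      ≈⟨ sign-+ (suc n) m ⟨
      sign (+ suc n ℤ.+ m)    ≡⟨ cong sign (ℤ.+-comm (+ suc n) m) ⟩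
      sign (m ℤ.+ + suc n)    ∎

  θ : Carrier → ℕ → ℕ → ℤ → Carrier
  θ σ u v i = σ ^ ∣ i ∣ ⊗ q ^ thetaExponent u v i

  θ-isTheta : ∀ {σ} → σ ⊗ σ ≈ 1# → ∀ u v → IsTheta (σ ⊗ q ^ u) (σ ⊗ q ^ v) (q ^ (u + v)) (θ σ u v)
  θ-isTheta {σ} σ⊗σ u v = record
    { a⊗b   = begin
        (σ ⊗ q ^ u) ⊗ (σ ⊗ q ^ v) ≈⟨ solve 3 (λ s a b → (s :* a) :* (s :* b) := (s :* s) :* (a :* b)) ≈-refl σ (q ^ u) (q ^ v) ⟩
        (σ ⊗ σ) ⊗ (q ^ u ⊗ q ^ v) ≈⟨ *-cong σ⊗σ (sym (^-homo-* q u v)) ⟩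
        1# ⊗ q ^ (u + v)          ≈⟨ *-identityˡ _ ⟩
        q ^ (u + v)               ∎
    ; T₀    = *-identityˡ 1#
    ; T-suc = next u
    ; T-neg = λ n → trans (next v n) (*-congˡ (reflexive (cong₂ (λ m e → σ ^ m ⊗ q ^ e)
                (≡.sym (ℤ.∣-i∣≡∣i∣ (+ n))) (≡.sym (thetaExponent-neg u v n)))))
    }
    where
    next : ∀ t n → σ ^ suc n ⊗ q ^ halfExponent (u + v) t (suc n) ≈
                   σ ⊗ q ^ t ⊗ (q ^ (u + v)) ^ n ⊗ (σ ^ n ⊗ q ^ halfExponent (u + v) t n)
    next t n = begin
      (σ ⊗ σ ^ n) ⊗ q ^ (t + n ℕ.* (u + v) + e)
        ≈⟨ *-congˡ (trans (^-homo-* q (t + n ℕ.* (u + v)) e) (*-congʳ (^-homo-* q t (n ℕ.* (u + v))))) ⟩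
      (σ ⊗ σ ^ n) ⊗ (q ^ t ⊗ q ^ (n ℕ.* (u + v)) ⊗ q ^ e)
        ≡⟨ cong (λ m → (σ ⊗ σ ^ n) ⊗ (q ^ t ⊗ q ^ m ⊗ q ^ e)) (ℕ.*-comm n (u + v)) ⟩
      (σ ⊗ σ ^ n) ⊗ (q ^ t ⊗ q ^ ((u + v) ℕ.* n) ⊗ q ^ e)
        ≈⟨ *-congˡ (*-congʳ (*-congˡ (^-assocʳ q (u + v) n))) ⟨
      (σ ⊗ σ ^ n) ⊗ (q ^ t ⊗ (q ^ (u + v)) ^ n ⊗ q ^ e)
        ≈⟨ solve 5 (λ s sⁿ a p e → (s :* sⁿ) :* (a :* p :* e) := s :* a :* p :* (sⁿ :* e))
             ≈-refl σ (σ ^ n) (q ^ t) ((q ^ (u + v)) ^ n) (q ^ e) ⟩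
      σ ⊗ q ^ t ⊗ (q ^ (u + v)) ^ n ⊗ (σ ^ n ⊗ q ^ e)
        ∎
      where
      e : ℕ
      e = halfExponent (u + v) t n

  module _ (qᴺ≈0 : q ^ N ≈ 0#) where

    term-vanish : ∀ {e} σ → N ≤ e → 1# ⊕ σ ⊗ q ^ e ≈ 1#
    term-vanish σ N≤e = trans (+-congˡ (trans (*-congˡ (^-vanish qᴺ≈0 N≤e)) (zeroʳ σ))) (+-identityʳ 1#)

    θ-vanishing : ∀ {σ u v} → 1 ≤ u → 1 ≤ v → Vanishing (θ σ u v)
    θ-vanishing 1≤u 1≤v i N≤∣i∣ =
      trans (*-congˡ (^-vanish qᴺ≈0 (ℕ.≤-trans N≤∣i∣ (∣n∣≤thetaExponent i 1≤u 1≤v)))) (zeroʳ _)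

    power-vanish : ∀ {w} → 1 ≤ w → (q ^ w) ^ N ≈ 0#
    power-vanish {w} 1≤w = trans (^-assocʳ q w N)
      (^-vanish qᴺ≈0 (subst (_≤ w ℕ.* N) (ℕ.*-identityˡ N) (ℕ.*-monoˡ-≤ N 1≤w)))

    pochhammer≈Φ : ∀ w K → Gaussian.pochhammer (q ^ w) K ≈ Φ -1# w w K
    pochhammer≈Φ w K = ∏-cong K λ j _ → +-congˡ (*-congˡ (trans (^-assocʳ q w (suc j))
      (^-congʳ q (ℕ.*-comm w (suc j)))))

    -- The witness is the central Gaussian binomial: it tends to the reciprocal of the Euler
    -- product, and modulo q^N it equals it once K ≥ N.
    Φ-inverse : ∀ {w K} → 1 ≤ w → N ≤ K → ∃[ y ] y ⊗ Φ -1# w w K ≈ 1#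
    Φ-inverse {w} {K} 1≤w N≤K = binomial (K + K) K ,
      trans (*-congˡ (sym (pochhammer≈Φ w K)))
        (trans (*-comm _ _) (binomial-pochhammer-limit (power-vanish 1≤w) N≤K N≤K N≤K))
      where open Gaussian (q ^ w)

    θ-product : ∀ {σ} → σ ⊗ σ ≈ 1# → ∀ {u v K} → 1 ≤ u → 1 ≤ v → N ℕ.* 2 ≤ K →
                ∑ℤ (θ σ u v) ≈ Φ -1# (u + v) (u + v) K ⊗ (Φ σ u (u + v) K ⊗ Φ σ v (u + v) K)
    θ-product {σ} σ⊗σ {u} {v} {K} 1≤u 1≤v 2N≤K = begin
      ∑ℤ (θ σ u v)
        ≈⟨ ∑-window (θ-vanishing 1≤u 1≤v) N≤K (ℕ.m≤n⇒m≤1+n (subst (K + N ≤_) (≡.sym (n*2≡n+n K)) (ℕ.+-monoʳ-≤ K N≤K))) ⟨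
      ∑ (suc (K ℕ.* 2)) (λ k → θ σ u v (k ⊖ K))
        ≈⟨ jacobi (θ-isTheta σ⊗σ u v) (power-vanish (ℕ.m≤n⇒m≤n+o v 1≤u)) 2N≤K (θ-vanishing 1≤u 1≤v) ⟨
      Gaussian.pochhammer (q ^ (u + v)) K ⊗ ∏ K (factor (θ-isTheta σ⊗σ u v))
        ≈⟨ *-cong (pochhammer≈Φ (u + v) K) (∏-cong K (λ j _ → *-cong (term u j) (term v j))) ⟩
      Φ -1# (u + v) (u + v) K ⊗ ∏ K (λ j → (1# ⊕ σ ⊗ q ^ (u + j ℕ.* (u + v))) ⊗ (1# ⊕ σ ⊗ q ^ (v + j ℕ.* (u + v))))
        ≈⟨ *-congˡ (∏-⊗ K _ _) ⟩
      Φ -1# (u + v) (u + v) K ⊗ (Φ σ u (u + v) K ⊗ Φ σ v (u + v) K)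
        ∎
      where
      N≤K : N ≤ K
      N≤K = ℕ.≤-trans (ℕ.m≤m*n N 2) 2N≤K
      term : ∀ t j → 1# ⊕ σ ⊗ q ^ t ⊗ (q ^ (u + v)) ^ j ≈ 1# ⊕ σ ⊗ q ^ (t + j ℕ.* (u + v))
      term t j = +-congˡ (trans (*-assoc _ _ _) (*-congˡ (begin
        q ^ t ⊗ (q ^ (u + v)) ^ j    ≈⟨ *-congˡ (^-assocʳ q (u + v) j) ⟩
        q ^ t ⊗ q ^ ((u + v) ℕ.* j)  ≡⟨ cong (λ e → q ^ t ⊗ q ^ e) (ℕ.*-comm (u + v) j) ⟩
        q ^ t ⊗ q ^ (j ℕ.* (u + v))  ≈⟨ ^-homo-* q t (j ℕ.* (u + v)) ⟨
        q ^ (t + j ℕ.* (u + v))      ∎)))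

    -- The sign (-1)^(m+n) equals (-1)^(m-n) and so depends on d alone. This is why the series in s
    -- is unsigned and the one in d alternates.
    θ²-⊕-θ² : ∑ℤ (θ -1# 39 37) ⊗ ∑ℤ (θ -1# 39 37) ⊕ q ^ 18 ⊗ (∑ℤ (θ -1# 1 75) ⊗ ∑ℤ (θ -1# 1 75)) ≈
              ∑ℤ (θ 1# 20 18) ⊗ ∑ℤ (θ -1# 19 19)
    θ²-⊕-θ² = ∑²-⊕-∑² (θ-vanishing (s≤s z≤n) (s≤s z≤n)) (θ-vanishing (s≤s z≤n) (s≤s z≤n))
      (θ-vanishing (s≤s z≤n) (s≤s z≤n)) (θ-vanishing (s≤s z≤n) (s≤s z≤n))
      (λ m n → trans (reorder (-1# ^ ∣ m ∣) (q ^ e 39 37 m) (-1# ^ ∣ n ∣) (q ^ e 39 37 n))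
        (combine m n (m ℤ.+ n ℤ.- + 0) (begin
          q ^ e 39 37 m ⊗ q ^ e 39 37 n ≈⟨ ^-homo-* q (e 39 37 m) (e 39 37 n) ⟨
          q ^ (e 39 37 m + e 39 37 n)   ≡⟨ cong (q ^_) (thetaExponent-φ m n) ⟩
          _                             ∎)))
      (λ m n → trans (solve 5 (λ p s x t y → p :* ((s :* x) :* (t :* y)) := (s :* t) :* (p :* (x :* y)))
                        ≈-refl (q ^ 18) (-1# ^ ∣ m ∣) (q ^ e 1 75 m) (-1# ^ ∣ n ∣) (q ^ e 1 75 n))
        (combine m n (m ℤ.+ n ℤ.- + 1) (begin
          q ^ 18 ⊗ (q ^ e 1 75 m ⊗ q ^ e 1 75 n) ≈⟨ *-congˡ (^-homo-* q (e 1 75 m) (e 1 75 n)) ⟨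
          q ^ 18 ⊗ q ^ (e 1 75 m + e 1 75 n)     ≈⟨ ^-homo-* q 18 (e 1 75 m + e 1 75 n) ⟨
          q ^ (18 + (e 1 75 m + e 1 75 n))       ≡⟨ cong (q ^_) (thetaExponent-ψ m n) ⟩
          _                                      ∎)))
      where
      open Signs -1⊗-1 using (sign-⊗)
      e : ℕ → ℕ → ℤ → ℕ
      e = thetaExponent
      reorder : ∀ s x t y → (s ⊗ x) ⊗ (t ⊗ y) ≈ (s ⊗ t) ⊗ (x ⊗ y)
      reorder = solve 4 (λ s x t y → (s :* x) :* (t :* y) := (s :* t) :* (x :* y)) ≈-refl
      combine : ∀ m n s {p} → p ≈ q ^ (e 20 18 s + e 19 19 (m ℤ.- n)) →
                (-1# ^ ∣ m ∣ ⊗ -1# ^ ∣ n ∣) ⊗ p ≈ θ 1# 20 18 s ⊗ θ -1# 19 19 (m ℤ.- n)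
      combine m n s {p} p≈ = begin
        (-1# ^ ∣ m ∣ ⊗ -1# ^ ∣ n ∣) ⊗ p
          ≈⟨ *-cong (sign-⊗ m n) (trans p≈ (^-homo-* q (e 20 18 s) (e 19 19 (m ℤ.- n)))) ⟩
        -1# ^ ∣ m ℤ.- n ∣ ⊗ (q ^ e 20 18 s ⊗ q ^ e 19 19 (m ℤ.- n))
          ≈⟨ solve 3 (λ s x y → s :* (x :* y) := (con 1 :* x) :* (s :* y)) ≈-refl _ _ _ ⟩
        (1# ⊗ q ^ e 20 18 s) ⊗ (-1# ^ ∣ m ℤ.- n ∣ ⊗ q ^ e 19 19 (m ℤ.- n))
          ≈⟨ *-congʳ (*-congʳ (1^n≈1 ∣ s ∣)) ⟨
        θ 1# 20 18 s ⊗ θ -1# 19 19 (m ℤ.- n)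
          ∎
        where
        1^n≈1 : ∀ n → 1# ^ n ≈ 1#
        1^n≈1 zero    = ≈-refl
        1^n≈1 (suc n) = trans (*-identityˡ _) (1^n≈1 n)

    -- The smallest size missing from `sizes c n` is n + 1, so N ≤ n + 1 already makes every omitted
    -- factor equal to 1.
    ∏[1-q^]-stable : ∀ c {m n} → N ≤ suc n → n ≤ m → ∏[1-q^ sizes c m ] ≈ ∏[1-q^ sizes c n ]
    ∏[1-q^]-stable c {m} {n} N≤1+n n≤m = begin
      ∏[1-q^ sizes c m ]                 ≈⟨ ∏[1-q^]-concatMap (copies c) id m ⟩
      ∏ m (λ k → ∏[1-q^ copies c k ])    ≈⟨ ∏-cutoff n≤m (λ k n≤k → large k n≤k (c (suc k))) ⟩
      ∏ n (λ k → ∏[1-q^ copies c k ])    ≈⟨ ∏[1-q^]-concatMap (copies c) id n ⟨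
      ∏[1-q^ sizes c n ]                 ∎
      where
      large : ∀ k → n ≤ k → ∀ l → ∏[1-q^ replicate l (suc k) ] ≈ 1#
      large k n≤k zero    = ≈-refl
      large k n≤k (suc l) = trans
        (*-cong (term-vanish -1# (ℕ.≤-trans N≤1+n (s≤s n≤k))) (large k n≤k l)) (*-identityˡ 1#)

    -- The product identity in base q^76.

    module Modulo76 {K} (2N≤K : N ℕ.* 2 ≤ K) where

      E : ℕ → Carrier
      E r = Φ -1# r 76 K

      private
        N≤K : N ≤ K
        N≤K = ℕ.≤-trans (ℕ.m≤m*n N 2) 2N≤K

        -- Products in base q^38 are taken with K * 2 factors, so that splitting them by parity
        -- returns K factors in base q^76.
        2N≤2K : N ℕ.* 2 ≤ K ℕ.* 2
        2N≤2K = ℕ.≤-trans 2N≤K (ℕ.m≤m*n K 2)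

        A B C D H S : Carrier
        A = E 1 ⊗ E 75
        B = E 19 ⊗ E 57
        C = E 39 ⊗ E 37
        D = E 36 ⊗ E 40
        H = E 38 ⊗ E 38
        -- This is [18][20], paired by residues modulo 38 instead of by signs, which is how
        -- `Φ-parity` delivers it.
        S = (E 18 ⊗ E 56) ⊗ (E 20 ⊗ E 58)

      Φ-cutoff : ∀ r → Φ -1# r 76 (K ℕ.* 2) ≈ E r
      Φ-cutoff r = ∏-cutoff (ℕ.m≤m*n K 2) λ k K≤k → term-vanish -1#
        (ℕ.≤-trans N≤K (ℕ.≤-trans K≤k (ℕ.≤-trans (ℕ.m≤m*n k 76) (ℕ.m≤n+m (k ℕ.* 76) r))))

      -- In the limit [18][20] is (q^18, q^20; q^38)_∞; multiplied by (-q^18, -q^20; q^38)_∞ it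
      -- becomes (q^36, q^40; q^76)_∞, that is [36].
      S⊗Φ₊≈D : S ⊗ (Φ 1# 20 38 (K ℕ.* 2) ⊗ Φ 1# 18 38 (K ℕ.* 2)) ≈ D
      S⊗Φ₊≈D = begin
        S ⊗ (Φ 1# 20 38 (K ℕ.* 2) ⊗ Φ 1# 18 38 (K ℕ.* 2))
          ≈⟨ *-congʳ (*-cong (Φ-parity -1# 18 38 K) (Φ-parity -1# 20 38 K)) ⟨
        (Φ -1# 18 38 (K ℕ.* 2) ⊗ Φ -1# 20 38 (K ℕ.* 2)) ⊗ (Φ 1# 20 38 (K ℕ.* 2) ⊗ Φ 1# 18 38 (K ℕ.* 2))
          ≈⟨ solve 4 (λ a b c d → (a :* b) :* (c :* d) := (a :* d) :* (b :* c)) ≈-refl _ _ _ _ ⟩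
        (Φ -1# 18 38 (K ℕ.* 2) ⊗ Φ 1# 18 38 (K ℕ.* 2)) ⊗ (Φ -1# 20 38 (K ℕ.* 2) ⊗ Φ 1# 20 38 (K ℕ.* 2))
          ≈⟨ *-cong (Φ-difference-of-squares 18 38 (K ℕ.* 2)) (Φ-difference-of-squares 20 38 (K ℕ.* 2)) ⟩
        Φ -1# 36 76 (K ℕ.* 2) ⊗ Φ -1# 40 76 (K ℕ.* 2)
          ≈⟨ *-cong (Φ-cutoff 36) (Φ-cutoff 40) ⟩
        D
          ∎

      -- The triple product proves the identity with both sides multiplied by (q^76; q^76)_∞². On
      -- the left each squared series brings this factor; on the right it comes from (q^38;
      -- q^38)_∞², whose other part is [38]. The inverse from `Φ-inverse` then removes it.
      product-identity : S ⊗ (C ⊗ C ⊕ q ^ 18 ⊗ (A ⊗ A)) ≈ D ⊗ H ⊗ (B ⊗ B)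
      product-identity = begin
        S ⊗ (C ⊗ C ⊕ q ^ 18 ⊗ (A ⊗ A))
          ≈⟨ cancel _ ⟨
        (y ⊗ y) ⊗ ((E 76 ⊗ E 76) ⊗ (S ⊗ (C ⊗ C ⊕ q ^ 18 ⊗ (A ⊗ A))))
          ≈⟨ *-congˡ scaled ⟩
        (y ⊗ y) ⊗ ((E 76 ⊗ E 76) ⊗ (D ⊗ H ⊗ (B ⊗ B)))
          ≈⟨ cancel _ ⟩
        D ⊗ H ⊗ (B ⊗ B)
          ∎
        where
        y : Carrier
        y = proj₁ (Φ-inverse {76} {K} (s≤s z≤n) N≤K)
        yE≈1 : y ⊗ E 76 ≈ 1#
        yE≈1 = proj₂ (Φ-inverse {76} {K} (s≤s z≤n) N≤K)
        cancel : ∀ z → (y ⊗ y) ⊗ ((E 76 ⊗ E 76) ⊗ z) ≈ z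
        cancel z = begin
          (y ⊗ y) ⊗ ((E 76 ⊗ E 76) ⊗ z) ≈⟨ solve 3 (λ y e z → (y :* y) :* ((e :* e) :* z) := (y :* e) :* ((y :* e) :* z)) ≈-refl y (E 76) z ⟩
          (y ⊗ E 76) ⊗ ((y ⊗ E 76) ⊗ z) ≈⟨ trans (*-congʳ yE≈1) (trans (*-identityˡ _) (trans (*-congʳ yE≈1) (*-identityˡ _))) ⟩
          z                             ∎
        scaled : (E 76 ⊗ E 76) ⊗ (S ⊗ (C ⊗ C ⊕ q ^ 18 ⊗ (A ⊗ A))) ≈ (E 76 ⊗ E 76) ⊗ (D ⊗ H ⊗ (B ⊗ B))
        scaled = begin
          (E 76 ⊗ E 76) ⊗ (S ⊗ (C ⊗ C ⊕ q ^ 18 ⊗ (A ⊗ A)))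
            ≈⟨ solve 5 (λ e s c p a → (e :* e) :* (s :* (c :* c :+ p :* (a :* a))) :=
                 s :* ((e :* c) :* (e :* c) :+ p :* ((e :* a) :* (e :* a)))) ≈-refl (E 76) S C (q ^ 18) A ⟩
          S ⊗ ((E 76 ⊗ C) ⊗ (E 76 ⊗ C) ⊕ q ^ 18 ⊗ ((E 76 ⊗ A) ⊗ (E 76 ⊗ A)))
            ≈⟨ *-congˡ (+-cong (*-cong φ φ) (*-congˡ (*-cong ψ ψ))) ⟨
          S ⊗ (∑ℤ (θ -1# 39 37) ⊗ ∑ℤ (θ -1# 39 37) ⊕ q ^ 18 ⊗ (∑ℤ (θ -1# 1 75) ⊗ ∑ℤ (θ -1# 1 75)))
            ≈⟨ *-congˡ θ²-⊕-θ² ⟩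
          S ⊗ (∑ℤ (θ 1# 20 18) ⊗ ∑ℤ (θ -1# 19 19))
            ≈⟨ *-congˡ (*-cong (θ-product (*-identityˡ 1#) (s≤s z≤n) (s≤s z≤n) 2N≤2K)
                               (θ-product -1⊗-1 (s≤s z≤n) (s≤s z≤n) 2N≤2K)) ⟩
          S ⊗ ((Φ -1# 38 38 (K ℕ.* 2) ⊗ (Φ 1# 20 38 (K ℕ.* 2) ⊗ Φ 1# 18 38 (K ℕ.* 2))) ⊗
               (Φ -1# 38 38 (K ℕ.* 2) ⊗ (Φ -1# 19 38 (K ℕ.* 2) ⊗ Φ -1# 19 38 (K ℕ.* 2))))
            ≈⟨ solve 4 (λ s p d b → s :* ((p :* d) :* (p :* (b :* b))) := (s :* d) :* (p :* p) :* (b :* b)) ≈-refl S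
                 (Φ -1# 38 38 (K ℕ.* 2)) (Φ 1# 20 38 (K ℕ.* 2) ⊗ Φ 1# 18 38 (K ℕ.* 2)) (Φ -1# 19 38 (K ℕ.* 2)) ⟩
          (S ⊗ (Φ 1# 20 38 (K ℕ.* 2) ⊗ Φ 1# 18 38 (K ℕ.* 2))) ⊗ (Φ -1# 38 38 (K ℕ.* 2) ⊗ Φ -1# 38 38 (K ℕ.* 2)) ⊗
            (Φ -1# 19 38 (K ℕ.* 2) ⊗ Φ -1# 19 38 (K ℕ.* 2))
            ≈⟨ *-cong (*-cong S⊗Φ₊≈D (*-cong Φ₃₈ Φ₃₈)) (*-cong Φ₁₉ Φ₁₉) ⟩
          D ⊗ ((E 38 ⊗ E 76) ⊗ (E 38 ⊗ E 76)) ⊗ (B ⊗ B)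
            ≈⟨ solve 4 (λ d h e b → d :* ((h :* e) :* (h :* e)) :* (b :* b) := (e :* e) :* (d :* (h :* h) :* (b :* b)))
                 ≈-refl D (E 38) (E 76) B ⟩
          (E 76 ⊗ E 76) ⊗ (D ⊗ H ⊗ (B ⊗ B))
            ∎
          where
          φ = θ-product -1⊗-1 {39} {37} {K} (s≤s z≤n) (s≤s z≤n) 2N≤K
          ψ = θ-product -1⊗-1 {1} {75} {K} (s≤s z≤n) (s≤s z≤n) 2N≤K
          Φ₃₈ = Φ-parity -1# 38 38 K
          Φ₁₉ = Φ-parity -1# 19 38 K

      ∏E : List ℕ → Carrier
      ∏E = foldr (λ r p → E r ⊗ p) 1#

      -- The lists are the sorted denominator residues, in the form to which `sizes` evaluates. With
      -- P₁ = [1]²[19]²[36][38], P₂ = [19]²[37]²[36][38] and P₃ = [1]²[37]²[18][20], this is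
      -- `product-identity` after division.
      reciprocal-identity : ∀ {G₁ G₂ G₃} →
        G₁ ⊗ ∏E (1 ∷ 1 ∷ 19 ∷ 19 ∷ 36 ∷ 38 ∷ 38 ∷ 40 ∷ 57 ∷ 57 ∷ 75 ∷ 75 ∷ []) ≈ 1# →
        G₂ ⊗ ∏E (19 ∷ 19 ∷ 36 ∷ 37 ∷ 37 ∷ 38 ∷ 38 ∷ 39 ∷ 39 ∷ 40 ∷ 57 ∷ 57 ∷ []) ≈ 1# →
        G₃ ⊗ ∏E (1 ∷ 1 ∷ 18 ∷ 20 ∷ 37 ∷ 37 ∷ 39 ∷ 39 ∷ 56 ∷ 58 ∷ 75 ∷ 75 ∷ []) ≈ 1# →
        G₁ ⊕ q ^ 18 ⊗ G₂ ≈ G₃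
      reciprocal-identity {G₁} {G₂} {G₃} G₁-inverse G₂-inverse G₃-inverse = begin
        G₁ ⊕ q ^ 18 ⊗ G₂
          -- Inserting units Gᵢ ⊗ Pᵢ puts G₁ G₂ G₃ in both summands, so that the left side of
          -- `product-identity` can be factored out.
          ≈⟨ trans (*-congʳ G₃P₃≈1) (trans (*-identityˡ _) (+-cong (trans (*-congˡ G₂P₂≈1) (*-identityʳ G₁))
               (*-congˡ (trans (*-congˡ G₁P₁≈1) (*-identityʳ G₂))))) ⟨
        (G₃ ⊗ P₃) ⊗ (G₁ ⊗ (G₂ ⊗ P₂) ⊕ q ^ 18 ⊗ (G₂ ⊗ (G₁ ⊗ P₁)))
          ≈⟨ solve 10 (λ g₁ g₂ g₃ a b c d h s p →
               (g₃ :* ((a :* a) :* (c :* c) :* s)) :* (g₁ :* (g₂ :* ((b :* b) :* (c :* c) :* (d :* h))) :+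
                 p :* (g₂ :* (g₁ :* ((a :* a) :* (b :* b) :* (d :* h))))) :=
               (g₁ :* g₂ :* g₃ :* (a :* a) :* (b :* b) :* (c :* c) :* (d :* h)) :* (s :* (c :* c :+ p :* (a :* a))))
               ≈-refl G₁ G₂ G₃ A B C D H S (q ^ 18) ⟩
        (G₁ ⊗ G₂ ⊗ G₃ ⊗ (A ⊗ A) ⊗ (B ⊗ B) ⊗ (C ⊗ C) ⊗ (D ⊗ H)) ⊗ (S ⊗ (C ⊗ C ⊕ q ^ 18 ⊗ (A ⊗ A)))
          ≈⟨ *-congˡ product-identity ⟩
        (G₁ ⊗ G₂ ⊗ G₃ ⊗ (A ⊗ A) ⊗ (B ⊗ B) ⊗ (C ⊗ C) ⊗ (D ⊗ H)) ⊗ (D ⊗ H ⊗ (B ⊗ B))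
          ≈⟨ solve 8 (λ g₁ g₂ g₃ a b c d h →
               (g₁ :* g₂ :* g₃ :* (a :* a) :* (b :* b) :* (c :* c) :* (d :* h)) :* (d :* h :* (b :* b)) :=
               (g₁ :* ((a :* a) :* (b :* b) :* (d :* h))) :* ((g₂ :* ((b :* b) :* (c :* c) :* (d :* h))) :* g₃))
               ≈-refl G₁ G₂ G₃ A B C D H ⟩
        (G₁ ⊗ P₁) ⊗ ((G₂ ⊗ P₂) ⊗ G₃)
          ≈⟨ trans (*-congʳ G₁P₁≈1) (trans (*-identityˡ _) (trans (*-congʳ G₂P₂≈1) (*-identityˡ G₃))) ⟩
        G₃
          ∎
        where
        P₁ P₂ P₃ : Carrier
        P₁ = (A ⊗ A) ⊗ (B ⊗ B) ⊗ (D ⊗ H)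
        P₂ = (B ⊗ B) ⊗ (C ⊗ C) ⊗ (D ⊗ H)
        P₃ = (A ⊗ A) ⊗ (C ⊗ C) ⊗ S
        G₁P₁≈1 : G₁ ⊗ P₁ ≈ 1#
        G₁P₁≈1 = trans (*-congˡ (solve 7 (λ e₁ e₁₉ e₃₆ e₃₈ e₄₀ e₅₇ e₇₅ →
          ((e₁ :* e₇₅) :* (e₁ :* e₇₅)) :* ((e₁₉ :* e₅₇) :* (e₁₉ :* e₅₇)) :* ((e₃₆ :* e₄₀) :* (e₃₈ :* e₃₈)) :=
          e₁ :* (e₁ :* (e₁₉ :* (e₁₉ :* (e₃₆ :* (e₃₈ :* (e₃₈ :* (e₄₀ :* (e₅₇ :* (e₅₇ :* (e₇₅ :* (e₇₅ :* con 1))))))))))))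
          ≈-refl (E 1) (E 19) (E 36) (E 38) (E 40) (E 57) (E 75))) G₁-inverse
        G₂P₂≈1 : G₂ ⊗ P₂ ≈ 1#
        G₂P₂≈1 = trans (*-congˡ (solve 7 (λ e₁₉ e₃₆ e₃₇ e₃₈ e₃₉ e₄₀ e₅₇ →
          ((e₁₉ :* e₅₇) :* (e₁₉ :* e₅₇)) :* ((e₃₉ :* e₃₇) :* (e₃₉ :* e₃₇)) :* ((e₃₆ :* e₄₀) :* (e₃₈ :* e₃₈)) :=
          e₁₉ :* (e₁₉ :* (e₃₆ :* (e₃₇ :* (e₃₇ :* (e₃₈ :* (e₃₈ :* (e₃₉ :* (e₃₉ :* (e₄₀ :* (e₅₇ :* (e₅₇ :* con 1))))))))))))
          ≈-refl (E 19) (E 36) (E 37) (E 38) (E 39) (E 40) (E 57))) G₂-inverse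
        G₃P₃≈1 : G₃ ⊗ P₃ ≈ 1#
        G₃P₃≈1 = trans (*-congˡ (solve 8 (λ e₁ e₁₈ e₂₀ e₃₇ e₃₉ e₅₆ e₅₈ e₇₅ →
          ((e₁ :* e₇₅) :* (e₁ :* e₇₅)) :* ((e₃₉ :* e₃₇) :* (e₃₉ :* e₃₇)) :* ((e₁₈ :* e₅₆) :* (e₂₀ :* e₅₈)) :=
          e₁ :* (e₁ :* (e₁₈ :* (e₂₀ :* (e₃₇ :* (e₃₇ :* (e₃₉ :* (e₃₉ :* (e₅₆ :* (e₅₈ :* (e₇₅ :* (e₇₅ :* con 1))))))))))))
          ≈-refl (E 1) (E 18) (E 20) (E 37) (E 39) (E 56) (E 58) (E 75))) G₃-inverse

-- Integer power series and their truncations.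

Series : Set
Series = ℕ → ℤ

infixl 7 _⊛_
-- The Cauchy product, peeling off the constant term of the left factor. The laws then follow by
-- induction on the degree with f replaced by f ∘ suc.
_⊛_ : Series → Series → Series
(f ⊛ g) zero    = f 0 ℤ.* g 0
(f ⊛ g) (suc n) = f 0 ℤ.* g (suc n) ℤ.+ (f ∘ suc ⊛ g) n

X : Series
X 1 = + 1
X _ = + 0

one : Series
one zero    = + 1
one (suc _) = + 0

⊛-cong : ∀ {f f′ g g′ : Series} n → (∀ i → i ≤ n → f i ≡ f′ i) → (∀ i → i ≤ n → g i ≡ g′ i) → (f ⊛ g) n ≡ (f′ ⊛ g′) n
⊛-cong zero    f≡ g≡ = cong₂ ℤ._*_ (f≡ 0 z≤n) (g≡ 0 z≤n)
⊛-cong (suc n) f≡ g≡ = cong₂ ℤ._+_ (cong₂ ℤ._*_ (f≡ 0 z≤n) (g≡ (suc n) ℕ.≤-refl))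
  (⊛-cong n (λ i i≤n → f≡ (suc i) (s≤s i≤n)) (λ i i≤n → g≡ i (ℕ.m≤n⇒m≤1+n i≤n)))

⊛-zeroˡ : ∀ f n → ((λ _ → + 0) ⊛ f) n ≡ + 0
⊛-zeroˡ f zero    = refl
⊛-zeroˡ f (suc n) = ≡.trans (ℤ.+-identityˡ _) (⊛-zeroˡ f n)

⊛-identityˡ : ∀ f n → (one ⊛ f) n ≡ f n
⊛-identityˡ f zero    = ℤ.*-identityˡ (f 0)
⊛-identityˡ f (suc n) = ≡.trans (cong₂ ℤ._+_ (ℤ.*-identityˡ (f (suc n))) (⊛-zeroˡ f n)) (ℤ.+-identityʳ _)

⊛-distribʳ : ∀ h f g n → ((λ i → f i ℤ.+ g i) ⊛ h) n ≡ (f ⊛ h) n ℤ.+ (g ⊛ h) n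
⊛-distribʳ h f g zero    = ℤ.*-distribʳ-+ (h 0) (f 0) (g 0)
⊛-distribʳ h f g (suc n) = ≡.trans
  (cong₂ ℤ._+_ (ℤ.*-distribʳ-+ (h (suc n)) (f 0) (g 0)) (⊛-distribʳ h (f ∘ suc) (g ∘ suc) n))
  (interchange (f 0 ℤ.* h (suc n)) _ _ _)
  where open CommutativeSemigroupProperties ℤ.+-commutativeSemigroup using (interchange)

⊛-scaleˡ : ∀ c f g n → ((λ i → c ℤ.* f i) ⊛ g) n ≡ c ℤ.* (f ⊛ g) n
⊛-scaleˡ c f g zero    = ℤ.*-assoc c (f 0) (g 0)
⊛-scaleˡ c f g (suc n) = ≡.trans
  (cong₂ ℤ._+_ (ℤ.*-assoc c (f 0) (g (suc n))) (⊛-scaleˡ c (f ∘ suc) g n))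
  (≡.sym (ℤ.*-distribˡ-+ c _ _))

-- Peels the same sum from its other end; together with the definition this makes commutativity an
-- induction.
⊛-sucʳ : ∀ f g n → (f ⊛ g) (suc n) ≡ (f ⊛ g ∘ suc) n ℤ.+ f (suc n) ℤ.* g 0
⊛-sucʳ f g zero    = refl
⊛-sucʳ f g (suc n) = ≡.trans (cong (λ z → f 0 ℤ.* g (suc (suc n)) ℤ.+ z) (⊛-sucʳ (f ∘ suc) g n))
  (≡.sym (ℤ.+-assoc (f 0 ℤ.* g (suc (suc n))) _ _))

⊛-comm : ∀ f g n → (f ⊛ g) n ≡ (g ⊛ f) n
⊛-comm f g zero    = ℤ.*-comm (f 0) (g 0)
⊛-comm f g (suc n) = begin
  f 0 ℤ.* g (suc n) ℤ.+ (f ∘ suc ⊛ g) n ≡⟨ cong₂ ℤ._+_ (ℤ.*-comm (f 0) (g (suc n))) (⊛-comm (f ∘ suc) g n) ⟩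
  g (suc n) ℤ.* f 0 ℤ.+ (g ⊛ f ∘ suc) n ≡⟨ ℤ.+-comm (g (suc n) ℤ.* f 0) ((g ⊛ f ∘ suc) n) ⟩
  (g ⊛ f ∘ suc) n ℤ.+ g (suc n) ℤ.* f 0 ≡⟨ ⊛-sucʳ g f n ⟨
  (g ⊛ f) (suc n)                       ∎
  where open ≡.≡-Reasoning

⊛-assoc : ∀ f g h n → ((f ⊛ g) ⊛ h) n ≡ (f ⊛ (g ⊛ h)) n
⊛-assoc f g h zero    = ℤ.*-assoc (f 0) (g 0) (h 0)
⊛-assoc f g h (suc n) = begin
  f 0 ℤ.* g 0 ℤ.* h (suc n) ℤ.+ ((λ i → f 0 ℤ.* g (suc i) ℤ.+ (f ∘ suc ⊛ g) i) ⊛ h) n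
    ≡⟨ cong₂ ℤ._+_ (ℤ.*-assoc (f 0) (g 0) (h (suc n))) (⊛-distribʳ h (λ i → f 0 ℤ.* g (suc i)) (f ∘ suc ⊛ g) n) ⟩
  f 0 ℤ.* (g 0 ℤ.* h (suc n)) ℤ.+ (((λ i → f 0 ℤ.* g (suc i)) ⊛ h) n ℤ.+ ((f ∘ suc ⊛ g) ⊛ h) n)
    ≡⟨ cong (λ z → f 0 ℤ.* (g 0 ℤ.* h (suc n)) ℤ.+ z)
         (cong₂ ℤ._+_ (⊛-scaleˡ (f 0) (g ∘ suc) h n) (⊛-assoc (f ∘ suc) g h n)) ⟩
  f 0 ℤ.* (g 0 ℤ.* h (suc n)) ℤ.+ (f 0 ℤ.* (g ∘ suc ⊛ h) n ℤ.+ (f ∘ suc ⊛ (g ⊛ h)) n)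
    ≡⟨ ℤ.+-assoc (f 0 ℤ.* (g 0 ℤ.* h (suc n))) _ _ ⟨
  f 0 ℤ.* (g 0 ℤ.* h (suc n)) ℤ.+ f 0 ℤ.* (g ∘ suc ⊛ h) n ℤ.+ (f ∘ suc ⊛ (g ⊛ h)) n
    ≡⟨ cong (λ z → z ℤ.+ (f ∘ suc ⊛ (g ⊛ h)) n) (ℤ.*-distribˡ-+ (f 0) _ _) ⟨
  f 0 ℤ.* (g ⊛ h) (suc n) ℤ.+ (f ∘ suc ⊛ (g ⊛ h)) n
    ∎
  where open ≡.≡-Reasoning

X⊛f : ∀ f n → (X ⊛ f) (suc n) ≡ f n
X⊛f f n = ≡.trans (ℤ.+-identityˡ _) (≡.trans (⊛-cong n (λ { zero _ → refl ; (suc _) _ → refl }) (λ _ _ → refl)) (⊛-identityˡ f n))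

-- ℤ[[X]] modulo Xᴺ, where every infinite product and sum is finite.
truncatedSeries : ℕ → CommutativeRing 0ℓ 0ℓ
truncatedSeries N = record
  { Carrier = Series
  ; _≈_ = λ f g → ∀ n → n < N → f n ≡ g n
  ; _+_ = λ f g n → f n ℤ.+ g n
  ; _*_ = _⊛_
  ; -_  = λ f n → ℤ.- f n
  ; 0#  = λ _ → + 0
  ; 1#  = one
  ; isCommutativeRing = record
    { isRing = record
      { +-isAbelianGroup = record
        { isGroup = record
          { isMonoid = record
            { isSemigroup = record
              { isMagma = record
                { isEquivalence = record
                  { refl  = λ _ _ → refl
                  ; sym   = λ f≈g n n<N → ≡.sym (f≈g n n<N)
                  ; trans = λ f≈g g≈h n n<N → ≡.trans (f≈g n n<N) (g≈h n n<N)
                  }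
                ; ∙-cong = λ f≈f′ g≈g′ n n<N → cong₂ ℤ._+_ (f≈f′ n n<N) (g≈g′ n n<N)
                }
              ; assoc = λ f g h n _ → ℤ.+-assoc (f n) (g n) (h n)
              }
            ; identity = (λ f n _ → ℤ.+-identityˡ (f n)) , (λ f n _ → ℤ.+-identityʳ (f n))
            }
          ; inverse = (λ f n _ → ℤ.+-inverseˡ (f n)) , (λ f n _ → ℤ.+-inverseʳ (f n))
          ; ⁻¹-cong = λ f≈g n n<N → cong ℤ.-_ (f≈g n n<N)
          }
        ; comm = λ f g n _ → ℤ.+-comm (f n) (g n)
        }
      ; *-cong = λ f≈f′ g≈g′ n n<N → ⊛-cong n (λ i i≤n → f≈f′ i (ℕ.≤-<-trans i≤n n<N))
                                              (λ i i≤n → g≈g′ i (ℕ.≤-<-trans i≤n n<N))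
      ; *-assoc = λ f g h n _ → ⊛-assoc f g h n
      ; *-identity = (λ f n _ → ⊛-identityˡ f n) , (λ f n _ → ≡.trans (⊛-comm f one n) (⊛-identityˡ f n))
      ; distrib = (λ f g h n _ → begin
                     (f ⊛ (λ i → g i ℤ.+ h i)) n  ≡⟨ ⊛-comm f _ n ⟩
                     ((λ i → g i ℤ.+ h i) ⊛ f) n  ≡⟨ ⊛-distribʳ f g h n ⟩
                     (g ⊛ f) n ℤ.+ (h ⊛ f) n      ≡⟨ cong₂ ℤ._+_ (⊛-comm g f n) (⊛-comm h f n) ⟩
                     (f ⊛ g) n ℤ.+ (f ⊛ h) n      ∎)
                , (λ f g h n _ → ⊛-distribʳ f g h n)
      }
    ; *-comm = λ f g n _ → ⊛-comm f g n
    }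
  }
  where open ≡.≡-Reasoning

module _ (N : ℕ) where
  open CommutativeRing (truncatedSeries N) using (_≈_; semiring; 0#)
  open Exp semiring using (_^_)

  X^k⊛f-< : ∀ k f {n} → n < k → (X ^ k ⊛ f) n ≡ + 0
  X^k⊛f-< (suc k) f {zero}  _         = refl
  X^k⊛f-< (suc k) f {suc n} (s≤s n<k) =
    ≡.trans (⊛-assoc X (X ^ k) f (suc n)) (≡.trans (X⊛f (X ^ k ⊛ f) n) (X^k⊛f-< k f n<k))

  X^k⊛f-+ : ∀ k f n → (X ^ k ⊛ f) (k + n) ≡ f n
  X^k⊛f-+ zero    f n = ⊛-identityˡ f n
  X^k⊛f-+ (suc k) f n =
    ≡.trans (⊛-assoc X (X ^ k) f (suc (k + n))) (≡.trans (X⊛f (X ^ k ⊛ f) (k + n)) (X^k⊛f-+ k f n))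

  X^k⊛f-≥ : ∀ k f {n} → k ≤ n → (X ^ k ⊛ f) n ≡ f (n ∸ k)
  X^k⊛f-≥ k f {n} k≤n = ≡.trans (cong (X ^ k ⊛ f) (≡.sym (ℕ.m+[n∸m]≡n k≤n))) (X^k⊛f-+ k f (n ∸ k))

  X^N≈0 : X ^ N ≈ 0#
  X^N≈0 n n<N = ≡.trans (≡.sym (≡.trans (⊛-comm (X ^ N) one n) (⊛-identityˡ (X ^ N) n))) (X^k⊛f-< N one n<N)

-- Periodicity of the number of colours.

⌊⌋-⇔ : ∀ {P Q : Set} (P? : Dec P) (Q? : Dec Q) → (P → Q) → (Q → P) → ⌊ P? ⌋ ≡ ⌊ Q? ⌋
⌊⌋-⇔ (yes _) (yes _) _ _ = refl
⌊⌋-⇔ (yes p) (no ¬q) f _ = contradiction (f p) ¬q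
⌊⌋-⇔ (no ¬p) (yes q) _ g = contradiction (g q) ¬p
⌊⌋-⇔ (no _)  (no _)  _ _ = refl

-- Only the absolute difference needs care. If k ≤ r, then adding t turns r - k into t - (r - k),
-- which is where r ≤ t enters. The two numbers add up to t, so t divides both or neither.
signs-periodic : ∀ {t r} → r ≤ t → ∀ k → signs t r (t + k) ≡ signs t r k
signs-periodic {t} {r} r≤t k = cong₂ (λ a b → (if a then 1 else 0) + (if b then 1 else 0))
  (⌊⌋-⇔ (t ∣? ℕ.∣ t + k - r ∣) (t ∣? ℕ.∣ k - r ∣) (proj₁ minus) (proj₂ minus))
  (⌊⌋-⇔ (t ∣? (t + k + r)) (t ∣? (k + r))
    (λ d → ∣m+n∣m⇒∣n (subst (t ∣_) (ℕ.+-assoc t k r) d) ∣-refl)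
    (λ d → subst (t ∣_) (≡.sym (ℕ.+-assoc t k r)) (∣m∣n⇒∣m+n ∣-refl d)))
  where
  minus : (t ∣ ℕ.∣ t + k - r ∣ → t ∣ ℕ.∣ k - r ∣) × (t ∣ ℕ.∣ k - r ∣ → t ∣ ℕ.∣ t + k - r ∣)
  ∣m+n-m∣≡n : ∀ m n → ℕ.∣ m + n - m ∣ ≡ n
  ∣m+n-m∣≡n m n = ≡.trans (ℕ.∣-∣-comm (m + n) m) (ℕ.∣m-m+n∣≡n m n)
  minus with ℕ.≤-total r k
  ... | inj₁ r≤k with d , refl ← ℕ.m≤n⇒∃[o]m+o≡n r≤k =
      (λ e → subst (t ∣_) (≡.sym (∣m+n-m∣≡n r d)) (∣m+n∣m⇒∣n (subst (t ∣_) above e) ∣-refl))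
    , (λ e → subst (t ∣_) (≡.sym above) (∣m∣n⇒∣m+n ∣-refl (subst (t ∣_) (∣m+n-m∣≡n r d) e)))
    where
    regroup : ∀ t r d → t + (r + d) ≡ r + (t + d)
    regroup = ℕSolver.solve-∀
    above : ℕ.∣ t + (r + d) - r ∣ ≡ t + d
    above = ≡.trans (cong (λ m → ℕ.∣ m - r ∣) (regroup t r d)) (∣m+n-m∣≡n r (t + d))
  ... | inj₂ k≤r with d , refl ← ℕ.m≤n⇒∃[o]m+o≡n k≤r
                 with e , refl ← ℕ.m≤n⇒∃[o]m+o≡n r≤t =
      (λ p → subst (t ∣_) (≡.sym (ℕ.∣m-m+n∣≡n k d)) (∣m+n∣m⇒∣n (subst (t ∣_) (total k d e) ∣-refl) (subst (t ∣_) below p)))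
    , (λ p → subst (t ∣_) (≡.sym below) (∣m+n∣m⇒∣n
        (subst (t ∣_) (≡.trans (total k d e) (ℕ.+-comm (e + k) d)) ∣-refl) (subst (t ∣_) (ℕ.∣m-m+n∣≡n k d) p)))
    where
    regroup : ∀ k d e → k + d + e + k ≡ (k + d) + (e + k)
    regroup = ℕSolver.solve-∀
    total : ∀ k d e → k + d + e ≡ (e + k) + d
    total = ℕSolver.solve-∀
    below : ℕ.∣ k + d + e + k - (k + d) ∣ ≡ e + k
    below = ≡.trans (cong (λ m → ℕ.∣ m - (k + d) ∣) (regroup k d e)) (∣m+n-m∣≡n (k + d) (e + k))

colours-periodic : ∀ {t rs} → All (λ (r , _) → r ≤ t) rs → ∀ j k → colours t rs (j ℕ.* t + k) ≡ colours t rs k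
colours-periodic {t} rs≤t zero    k = refl
colours-periodic {t} {rs} rs≤t (suc j) k = begin
  colours t rs (t + j ℕ.* t + k)   ≡⟨ cong (colours t rs) (ℕ.+-assoc t (j ℕ.* t) k) ⟩
  colours t rs (t + (j ℕ.* t + k)) ≡⟨ step rs≤t (j ℕ.* t + k) ⟩
  colours t rs (j ℕ.* t + k)       ≡⟨ colours-periodic rs≤t j k ⟩
  colours t rs k                   ∎
  where
  open ≡.≡-Reasoning
  step : ∀ {rs} → All (λ (r , _) → r ≤ t) rs → ∀ k → colours t rs (t + k) ≡ colours t rs k
  step []                 k = refl
  step (_∷_ {x = r , m} r≤t rs≤t) k = cong₂ (λ s c → m ℕ.* s + c) (signs-periodic r≤t k) (step rs≤t k)

-- The recurrence satisfied by the number of enumerated partitions.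

open Part using (size)

size-positive : ∀ {c} (p : Part c) → 0 < size p
size-positive (part s {{s≢0}} _) = ℕ.>-nonZero⁻¹ s {{s≢0}}

module _ {c : ℕ → ℕ} (p : Part c) (ps : List (Part c)) where

  private
    s : ℕ
    s = size p

    fits? : ∀ n m → Dec (m ℕ.* s ≤ n)
    fits? n m = m ℕ.* s ≤? n

    block : ℕ → ℕ → List (List (Part c))
    block n m = map (replicate m p ++_) (enumerate ps (n ∸ m ℕ.* s))

    blocks : ℕ → List ℕ → List (List (Part c))
    blocks n ms = concatMap (block n) (filter (fits? n) ms)

    length-reject : ∀ {n} m ms → n < m ℕ.* s → length (blocks n (m ∷ ms)) ≡ length (blocks n ms)
    length-reject {n} m ms n<ms = cong (λ xs → length (concatMap (block n) xs))
      (filter-reject (fits? n) {x = m} {xs = ms} (ℕ.<⇒≱ n<ms))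

    length-accept : ∀ {n} m ms → m ℕ.* s ≤ n →
                    length (blocks n (m ∷ ms)) ≡ length (enumerate ps (n ∸ m ℕ.* s)) + length (blocks n ms)
    length-accept {n} m ms ms≤n = ≡.trans
      (cong (λ xs → length (concatMap (block n) xs)) (filter-accept (fits? n) {xs = ms} ms≤n))
      (≡.trans (length-++ (block n m))
        (cong (_+ length (blocks n ms)) (length-map (replicate m p ++_) (enumerate ps (n ∸ m ℕ.* s)))))

    blocks-< : ∀ {n} ms → n < s → length (blocks n (map suc ms)) ≡ 0
    blocks-< []       n<s = refl
    blocks-< (m ∷ ms) n<s = ≡.trans (length-reject (suc m) (map suc ms) (ℕ.<-≤-trans n<s (ℕ.m≤m+n s _))) (blocks-< ms n<s)

    -- Removing one copy of p matches multiplicity m + 1 for the total s + n with multiplicity m for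
    -- the total n; the remainder left for the other parts is the same.
    blocks-+ : ∀ n ms → length (blocks (s + n) (map suc ms)) ≡ length (blocks n ms)
    blocks-+ n []       = refl
    blocks-+ n (m ∷ ms) with ℕ.≤-<-connex (m ℕ.* s) n
    ... | inj₁ ms≤n = begin
      length (blocks (s + n) (map suc (m ∷ ms)))
        ≡⟨ length-accept (suc m) (map suc ms) (ℕ.+-monoʳ-≤ s ms≤n) ⟩
      length (enumerate ps (s + n ∸ (s + m ℕ.* s))) + length (blocks (s + n) (map suc ms))
        ≡⟨ cong₂ _+_ (cong (length ∘ enumerate ps) (ℕ.[m+n]∸[m+o]≡n∸o s n (m ℕ.* s))) (blocks-+ n ms) ⟩
      length (enumerate ps (n ∸ m ℕ.* s)) + length (blocks n ms)
        ≡⟨ length-accept m ms ms≤n ⟨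
      length (blocks n (m ∷ ms))
        ∎
      where open ≡.≡-Reasoning
    ... | inj₂ n<ms = ≡.trans (length-reject (suc m) (map suc ms) (ℕ.+-monoʳ-< s n<ms))
                       (≡.trans (blocks-+ n ms) (≡.sym (length-reject m ms n<ms)))

    blocks-∷ʳ : ∀ {n m} ms → n < m ℕ.* s → length (blocks n (ms ∷ʳ m)) ≡ length (blocks n ms)
    blocks-∷ʳ {n} {m} ms n<ms = cong (λ xs → length (concatMap (block n) xs)) (begin
      filter (fits? n) (ms ++ m ∷ [])        ≡⟨ filter-++ (fits? n) ms (m ∷ []) ⟩
      filter (fits? n) ms ++ filter (fits? n) (m ∷ []) ≡⟨ cong (filter (fits? n) ms ++_) (filter-reject (fits? n) {x = m} {xs = []} (ℕ.<⇒≱ n<ms)) ⟩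
      filter (fits? n) ms ++ []              ≡⟨ ++-identityʳ _ ⟩
      filter (fits? n) ms                    ∎)
      where
      open ≡.≡-Reasoning

    -- As s ≥ 1, multiplicities above n never fit. This reconciles the ranges of multiplicities,
    -- which `enumerate` makes depend on the total.
    blocks-upTo : ∀ n d → length (blocks n (upTo (suc n + d))) ≡ length (blocks n (upTo (suc n)))
    blocks-upTo n zero    = cong (λ m → length (blocks n (upTo (suc m)))) (ℕ.+-identityʳ n)
    blocks-upTo n (suc d) = begin
      length (blocks n (upTo (suc n + suc d)))           ≡⟨ cong (length ∘ blocks n ∘ upTo) (ℕ.+-suc (suc n) d) ⟩
      length (blocks n (upTo (suc (suc n + d))))         ≡⟨ cong (length ∘ blocks n) (upTo-∷ʳ (suc n + d)) ⟨
      length (blocks n (upTo (suc n + d) ∷ʳ (suc n + d))) ≡⟨ blocks-∷ʳ (upTo (suc n + d)) n<[1+n+d]*s ⟩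
      length (blocks n (upTo (suc n + d)))               ≡⟨ blocks-upTo n d ⟩
      length (blocks n (upTo (suc n)))                   ∎
      where
      open ≡.≡-Reasoning
      n<[1+n+d]*s : n < (suc n + d) ℕ.* s
      n<[1+n+d]*s = ℕ.≤-trans (ℕ.m≤m+n (suc n) d) (ℕ.m≤m*n (suc n + d) s {{ℕ.>-nonZero (size-positive p)}})

  length-enumerate-< : ∀ {n} → n < s → length (enumerate (p ∷ ps) n) ≡ length (enumerate ps n)
  length-enumerate-< {n} n<s = begin
    length (blocks n (upTo (suc n)))                                       ≡⟨ length-accept 0 (applyUpTo suc n) z≤n ⟩
    length (enumerate ps n) + length (blocks n (applyUpTo suc n))          ≡⟨ cong (λ ms → length (enumerate ps n) + length (blocks n ms)) (map-upTo suc n) ⟨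
    length (enumerate ps n) + length (blocks n (map suc (upTo n)))         ≡⟨ cong (λ l → length (enumerate ps n) + l) (blocks-< (upTo n) n<s) ⟩
    length (enumerate ps n) + 0                                            ≡⟨ ℕ.+-identityʳ _ ⟩
    length (enumerate ps n)                                                ∎
    where open ≡.≡-Reasoning

  -- Either p is absent, or one copy of it can be removed: the coefficient form of G′ = G + q^s G′.
  length-enumerate-+ : ∀ n → length (enumerate (p ∷ ps) (s + n)) ≡
                             length (enumerate ps (s + n)) + length (enumerate (p ∷ ps) n)
  length-enumerate-+ n = ≡.trans (length-accept 0 (applyUpTo suc (s + n)) z≤n) (cong (λ l → length (enumerate ps (s + n)) + l) (begin
    length (blocks (s + n) (applyUpTo suc (s + n)))        ≡⟨ cong (length ∘ blocks (s + n)) (map-upTo suc (s + n)) ⟨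
    length (blocks (s + n) (map suc (upTo (s + n))))       ≡⟨ blocks-+ n (upTo (s + n)) ⟩
    length (blocks n (upTo (s + n)))                       ≡⟨ cong (length ∘ blocks n ∘ upTo) extend ⟩
    length (blocks n (upTo (suc n + ℕ.pred s)))             ≡⟨ blocks-upTo n (ℕ.pred s) ⟩
    length (blocks n (upTo (suc n)))                       ∎))
    where
    open ≡.≡-Reasoning
    -- After one copy is removed the range is still that of the total s + n, longer by s - 1 than
    -- the range for n.
    extend : s + n ≡ suc n + ℕ.pred s
    extend = begin
      s + n             ≡⟨ cong (_+ n) (ℕ.suc-pred s {{ℕ.>-nonZero (size-positive p)}}) ⟨
      suc (ℕ.pred s) + n  ≡⟨ cong suc (ℕ.+-comm (ℕ.pred s) n) ⟩
      suc n + ℕ.pred s    ∎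

generating : ∀ {c} → List (Part c) → Series
generating ps n = + length (enumerate ps n)

sizes-partsUpTo : ∀ c n → map size (partsUpTo c n) ≡ sizes c n
sizes-partsUpTo c n = ≡.trans (map-concatMap size _ (upTo n)) (concatMap-cong copies-size (upTo n))
  where
  map-const : ∀ {A : Set} (x : ℕ) (ys : List A) → map (λ _ → x) ys ≡ replicate (length ys) x
  map-const x []       = refl
  map-const x (_ ∷ ys) = cong (x ∷_) (map-const x ys)
  copies-size : ∀ k → map size (map (part (suc k)) (allFin (c (suc k)))) ≡ copies c k
  copies-size k = ≡.trans (≡.sym (map-∘ (allFin (c (suc k)))))
    (≡.trans (map-const (suc k) (allFin (c (suc k)))) (cong (λ m → replicate m (suc k)) (length-tabulate {n = c (suc k)} id)))

colours₁ colours₂ colours₃ : List (ℕ × ℕ)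
colours₁ = (1 , 2) ∷ (19 , 2) ∷ (36 , 1) ∷ (38 , 1) ∷ []
colours₂ = (19 , 2) ∷ (36 , 1) ∷ (37 , 2) ∷ (38 , 1) ∷ []
colours₃ = (1 , 2) ∷ (18 , 1) ∷ (20 , 1) ∷ (37 , 2) ∷ []

-- Generating functions of partitions and the comparison of coefficients.

module GeneratingFunction (N : ℕ) where
  open CommutativeRing (truncatedSeries N) renaming (_+_ to _⊕_; _*_ to _⊗_; refl to ≈-refl; -_ to ⊝_) hiding (_-_; zero)
  open JacobiTripleProduct (truncatedSeries N)
  open TruncatedTheta (truncatedSeries N) X N

  generating-∷ : ∀ {c} (p : Part c) ps → generating (p ∷ ps) ≈ generating ps ⊕ X ^ size p ⊗ generating (p ∷ ps)
  generating-∷ p ps n _ with ℕ.<-≤-connex n (size p)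
  ... | inj₁ n<s = ≡.trans (cong +_ (length-enumerate-< p ps n<s))
    (≡.sym (≡.trans (cong (λ z → generating ps n ℤ.+ z) (X^k⊛f-< N (size p) (generating (p ∷ ps)) n<s)) (ℤ.+-identityʳ _)))
  ... | inj₂ s≤n with m , refl ← ℕ.m≤n⇒∃[o]m+o≡n s≤n = ≡.trans (cong +_ (length-enumerate-+ p ps m))
    (cong (λ z → generating ps (size p + m) ℤ.+ z) (≡.sym (X^k⊛f-+ N (size p) (generating (p ∷ ps)) m)))

  generating-product : ∀ {c} (ps : List (Part c)) → generating ps ⊗ ∏[1-q^ map size ps ] ≈ 1#
  generating-product []       = trans (*-identityʳ (generating [])) λ { zero _ → refl ; (suc _) _ → refl }
  generating-product (p ∷ ps) = trans
    (geometric {generating ps} {generating (p ∷ ps)} {X ^ size p} {∏[1-q^ map size ps ]} (generating-∷ p ps))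
    (generating-product ps)

  generating-partsUpTo-product : ∀ c n → generating (partsUpTo c n) ⊗ ∏[1-q^ sizes c n ] ≈ 1#
  generating-partsUpTo-product c n = subst (λ rs → generating (partsUpTo c n) ⊗ ∏[1-q^ rs ] ≈ 1#)
    (sizes-partsUpTo c n) (generating-product (partsUpTo c n))

  -- Both series are inverse to products that agree modulo X^N, so they agree as well.
  generating-stable : ∀ c {m n} → N ≤ suc n → n ≤ m → generating (partsUpTo c m) ≈ generating (partsUpTo c n)
  generating-stable c {m} {n} N≤1+n n≤m = inverse-unique {generating (partsUpTo c m)} {generating (partsUpTo c n)}
    {∏[1-q^ sizes c m ]} {∏[1-q^ sizes c n ]}
    (generating-partsUpTo-product c m) (generating-partsUpTo-product c n) (∏[1-q^]-stable (X^N≈0 N) c N≤1+n n≤m)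

  generating-identity : ∀ K → N ℕ.* 2 ≤ K → ∀ n → n < N →
    generating (partsUpTo (colours 76 colours₁) (K ℕ.* 76)) n ℤ.+
      (X ^ 18 ⊛ generating (partsUpTo (colours 76 colours₂) (K ℕ.* 76))) n ≡
    generating (partsUpTo (colours 76 colours₃) (K ℕ.* 76)) n
  generating-identity K 2N≤K = reciprocal-identity {G colours₁} {G colours₂} {G colours₃}
    -- Each `refl` evaluates the coloured residues from 1 to 76 to the list in
    -- `reciprocal-identity`. In the first two lists 38 appears twice, because `signs` counts +38
    -- and -38 separately.
    (inverse (from-yes (All.all? (λ (r , _) → r ≤? 76) colours₁)) refl)
    (inverse (from-yes (All.all? (λ (r , _) → r ≤? 76) colours₂)) refl)
    (inverse (from-yes (All.all? (λ (r , _) → r ≤? 76) colours₃)) refl)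
    where
    open Modulo76 (X^N≈0 N) {K} 2N≤K

    G : List (ℕ × ℕ) → Series
    G rs = generating (partsUpTo (colours 76 rs) (K ℕ.* 76))

    inverse : ∀ {rs ss} → All (λ (r , _) → r ≤ 76) rs → sizes (colours 76 rs) 76 ≡ ss → G rs ⊗ ∏E ss ≈ 1#
    inverse {rs} rs≤76 refl = trans
      (*-congˡ {x = G rs} (sym (∏[1-q^]-periodic 76 K (colours-periodic rs≤76))))
      (generating-partsUpTo-product (colours 76 rs) (K ℕ.* 76))

-- Truncation at n + 1 is the least that still sees the coefficient of X^n, and it permits any list
-- of parts reaching at least n.
generating-partsUpTo : ∀ c {m n} → n ≤ m → generating (partsUpTo c m) n ≡ + countPartitions c n
generating-partsUpTo c {m} {n} n≤m = generating-stable c ℕ.≤-refl n≤m n ℕ.≤-refl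
  where open GeneratingFunction (suc n) using (generating-stable)

countPartitions-identity : ∀ n K → 18 ≤ n → suc n ℕ.* 2 ≤ K →
  countPartitions (colours 76 colours₁) n + countPartitions (colours 76 colours₂) (n ∸ 18) ≡
  countPartitions (colours 76 colours₃) n
countPartitions-identity n K 18≤n 2N≤K = ℤ.+-injective (begin
  + countPartitions (colours 76 colours₁) n ℤ.+ + countPartitions (colours 76 colours₂) (n ∸ 18)
    ≡⟨ cong₂ ℤ._+_ (generating-partsUpTo (colours 76 colours₁) n≤M)
                   (generating-partsUpTo (colours 76 colours₂) (ℕ.≤-trans (ℕ.m∸n≤m n 18) n≤M)) ⟨
  G colours₁ n ℤ.+ G colours₂ (n ∸ 18)
    -- Here 18 ≤ n is essential: below 18 the coefficient of X^n is 0, whereas n ∸ 18 would be 0 and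
    -- would count the empty partition.
    ≡⟨ cong (λ z → G colours₁ n ℤ.+ z) (X^k⊛f-≥ (suc n) 18 (G colours₂) 18≤n) ⟨
  G colours₁ n ℤ.+ (X ^ 18 ⊛ G colours₂) n
    ≡⟨ generating-identity K 2N≤K n ℕ.≤-refl ⟩
  G colours₃ n
    ≡⟨ generating-partsUpTo (colours 76 colours₃) n≤M ⟩
  + countPartitions (colours 76 colours₃) n
    ∎)
  where
  open ≡.≡-Reasoning
  open JacobiTripleProduct (truncatedSeries (suc n)) using (_^_)
  open GeneratingFunction (suc n) using (generating-identity)

  G : List (ℕ × ℕ) → Series
  G rs = generating (partsUpTo (colours 76 rs) (K ℕ.* 76))

  n≤M : n ≤ K ℕ.* 76
  n≤M = ℕ.≤-trans (ℕ.n≤1+n n) (ℕ.≤-trans (ℕ.m≤m*n (suc n) 2) (ℕ.≤-trans 2N≤K (ℕ.m≤m*n K 76)))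

theorem5p2 : (n : ℕ) → 18 ≤ n → F₁ n + F₂ (n ∸ 18) ≡ F₃ n
-- With N = n + 1, the choice K = 2N is the least that the bound N * 2 ≤ K admits.
theorem5p2 n 18≤n = countPartitions-identity n (suc n ℕ.* 2) 18≤n ℕ.≤-refl
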